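{- Let $f(x,\lambda)$ be an irrationality measure, and let $\lambda>0$ be a fixed value such that $f(x,\lambda)=o(x^{ -2})$ as $x\to\infty$. Suppose further that for any $\varepsilon>0$ there exists a positive constant $c=c(\varepsilon)<1$, independent of $x$, such that $f(x,\lambda+\varepsilon)<c\,f(x,\lambda)$ for all $x$ sufficiently large. Then there exists an irrational number $\theta_\lambda$ which has irrationality measure $f(x,\lambda)$ and is approximable to order $\omega(x)=f(x,\lambda)$.
   Context: An irrationality measure is a function $f(x,\lambda)$, defined for real $x\ge1$ and $\lambda>0$, which takes values in the positive reals and is strictly decreasing in both $x$ and $\lambda$. Let $\alpha$ be irrational. If there exists $\lambda>0$ with the property that for any $\varepsilon>0$ there is a positive integer $q(\varepsilon)$ such that $\left|\alpha-\frac pq\right|>f(q,\lambda+\varepsilon)$ for all integers $p,q$ with $q\ge q(\varepsilon)$, then $\lambda(\alpha)$ denotes the least such $\lambda$, and $\alpha$ is said to have irrationality measure $f(x,\lambda(\alpha))$. Thus "$\alpha$ has irrationality measure $f(x,\lambda)$" for a given $\lambda$ means that $\lambda(\alpha)=\lambda$. If no such $\lambda$ exists, $\lambda(\alpha)=\infty$. Given a real number $\theta$ and a positive real-valued function $\omega(x)$ defined for $x\ge1$, $\theta$ is approximable to order $\omega$ if for every $C>0$ there exists a pair of integers $p,q$, with $q>C$, such that $\left|\theta-\frac pq\right|<\omega(q)$. -}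

module Defs where

open import Data.Nat as ℕ using (ℕ; suc; NonZero)
import Data.Nat.Properties as ℕ
open import Data.Integer as ℤ using (ℤ; +_)
import Data.Integer.Properties as ℤ
open import Data.Rational as ℚ using (ℚ; 0ℚ; 1ℚ; ½)
import Data.Rational.Properties as ℚ
import Data.Rational.Solver as ℚ
import Data.Rational.Unnormalised as ℚᵘ
import Data.Rational.Unnormalised.Properties as ℚᵘ
open import Data.Product using (Σ; ∃; ∃-syntax; Σ-syntax; _×_; _,_; proj₁; proj₂)
open import Data.Sum using (inj₁; inj₂)
open import Relation.Nullary using (¬_; yes; no; contradiction)
open import Relation.Binary.PropositionalEquality using (_≡_; refl; sym; trans; cong; cong₂; subst; subst₂)

private
  open ℚ.+-*-Solver using (solve; _:=_; _:+_; _:-_; _:*_; :-_; con)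

  |x-y|≡|y-x| : ∀ x y → ℚ.∣ x ℚ.- y ∣ ≡ ℚ.∣ y ℚ.- x ∣
  |x-y|≡|y-x| x y = trans (sym (ℚ.∣-p∣≡∣p∣ (x ℚ.- y)))
    (cong ℚ.∣_∣ (solve 2 (λ x y → :- (x :- y) := y :- x) refl x y))

  x≤|x| : ∀ x → x ℚ.≤ ℚ.∣ x ∣
  x≤|x| x with ℚ.≤-total 0ℚ x
  ... | inj₁ 0≤x = ℚ.≤-reflexive (sym (ℚ.0≤p⇒∣p∣≡p 0≤x))
  ... | inj₂ x≤0 = ℚ.≤-trans x≤0 (ℚ.0≤∣p∣ x)

  |x|≤ : ∀ {x y} → x ℚ.≤ y → ℚ.- x ℚ.≤ y → ℚ.∣ x ∣ ℚ.≤ y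
  |x|≤ {x} x≤y -x≤y with ℚ.∣p∣≡p∨∣p∣≡-p x
  ... | inj₁ e = subst (ℚ._≤ _) (sym e) x≤y
  ... | inj₂ e = subst (ℚ._≤ _) (sym e) -x≤y

  ≤+⇒-≤ : ∀ {x y z} → x ℚ.≤ z ℚ.+ y → x ℚ.- y ℚ.≤ z
  ≤+⇒-≤ {x} {y} {z} h = subst (x ℚ.- y ℚ.≤_)
    (solve 2 (λ z y → z :+ y :- y := z) refl z y) (ℚ.+-monoˡ-≤ (ℚ.- y) h)

  <+⇒-< : ∀ {x y z} → x ℚ.< z ℚ.+ y → x ℚ.- y ℚ.< z
  <+⇒-< {x} {y} {z} h = subst (x ℚ.- y ℚ.<_)
    (solve 2 (λ z y → z :+ y :- y := z) refl z y) (ℚ.+-monoˡ-< (ℚ.- y) h)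

  -≤⇒≤+ : ∀ {x y z} → x ℚ.- y ℚ.≤ z → x ℚ.≤ z ℚ.+ y
  -≤⇒≤+ {x} {y} {z} h = subst (ℚ._≤ z ℚ.+ y)
    (solve 2 (λ x y → x :- y :+ y := x) refl x y) (ℚ.+-monoˡ-≤ y h)

  |x|≤|x-y|+|y| : ∀ x y → ℚ.∣ x ∣ ℚ.≤ ℚ.∣ x ℚ.- y ∣ ℚ.+ ℚ.∣ y ∣
  |x|≤|x-y|+|y| x y = subst (λ z → ℚ.∣ z ∣ ℚ.≤ ℚ.∣ x ℚ.- y ∣ ℚ.+ ℚ.∣ y ∣)
    (solve 2 (λ x y → x :- y :+ y := x) refl x y) (ℚ.∣p+q∣≤∣p∣+∣q∣ (x ℚ.- y) y)

  reverse-triangle : ∀ x y → ℚ.∣ ℚ.∣ x ∣ ℚ.- ℚ.∣ y ∣ ∣ ℚ.≤ ℚ.∣ x ℚ.- y ∣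
  reverse-triangle x y = |x|≤ (≤+⇒-≤ (|x|≤|x-y|+|y| x y))
    (subst (ℚ._≤ ℚ.∣ x ℚ.- y ∣) (solve 2 (λ a b → b :- a := :- (a :- b)) refl ℚ.∣ x ∣ ℚ.∣ y ∣)
      (≤+⇒-≤ (subst (λ d → ℚ.∣ y ∣ ℚ.≤ d ℚ.+ ℚ.∣ x ∣) (|x-y|≡|y-x| y x) (|x|≤|x-y|+|y| y x))))

  half : ℚ → ℚ
  half ε = ½ ℚ.* ε

  half-pos : ∀ {ε} → 0ℚ ℚ.< ε → 0ℚ ℚ.< half ε
  half-pos {ε} 0<ε = subst (ℚ._< half ε) (ℚ.*-zeroʳ ½) (ℚ.*-monoʳ-<-pos ½ 0<ε)

  half+half : ∀ ε → half ε ℚ.+ half ε ≡ ε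
  half+half = solve 1 (λ ε → con ½ :* ε :+ con ½ :* ε := ε) refl

  |product-difference| : ∀ {K δ ε} a a′ b b′ → 0ℚ ℚ.≤ K → ℚ.∣ a ∣ ℚ.≤ K → ℚ.∣ b′ ∣ ℚ.≤ K →
    ℚ.∣ a ℚ.- a′ ∣ ℚ.≤ δ → ℚ.∣ b ℚ.- b′ ∣ ℚ.≤ δ → K ℚ.* δ ℚ.+ K ℚ.* δ ℚ.< ε →
    ℚ.∣ a ℚ.* b ℚ.- a′ ℚ.* b′ ∣ ℚ.< ε
  |product-difference| {K} {δ} {ε} a a′ b b′ 0≤K |a|≤K |b′|≤K da db Kδ<ε = begin-strict
    ℚ.∣ a ℚ.* b ℚ.- a′ ℚ.* b′ ∣
      ≡⟨ cong ℚ.∣_∣ (solve 4 (λ a a′ b b′ →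
           a :* b :- a′ :* b′ := a :* (b :- b′) :+ b′ :* (a :- a′)) refl a a′ b b′) ⟩
    ℚ.∣ a ℚ.* (b ℚ.- b′) ℚ.+ b′ ℚ.* (a ℚ.- a′) ∣
      ≤⟨ ℚ.∣p+q∣≤∣p∣+∣q∣ (a ℚ.* (b ℚ.- b′)) (b′ ℚ.* (a ℚ.- a′)) ⟩
    ℚ.∣ a ℚ.* (b ℚ.- b′) ∣ ℚ.+ ℚ.∣ b′ ℚ.* (a ℚ.- a′) ∣
      ≤⟨ ℚ.+-mono-≤ (bound a (b ℚ.- b′) |a|≤K db) (bound b′ (a ℚ.- a′) |b′|≤K da) ⟩
    K ℚ.* δ ℚ.+ K ℚ.* δ
      <⟨ Kδ<ε ⟩
    ε ∎
    where
    open ℚ.≤-Reasoning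
    bound : ∀ u v → ℚ.∣ u ∣ ℚ.≤ K → ℚ.∣ v ∣ ℚ.≤ δ → ℚ.∣ u ℚ.* v ∣ ℚ.≤ K ℚ.* δ
    bound u v hu hv = begin
      ℚ.∣ u ℚ.* v ∣        ≡⟨ ℚ.∣p*q∣≡∣p∣*∣q∣ u v ⟩
      ℚ.∣ u ∣ ℚ.* ℚ.∣ v ∣  ≤⟨ ℚ.*-monoʳ-≤-nonNeg ℚ.∣ v ∣ {{ℚ.∣-∣-nonNeg v}} hu ⟩
      K ℚ.* ℚ.∣ v ∣        ≤⟨ ℚ.*-monoˡ-≤-nonNeg K {{ℚ.nonNegative 0≤K}} hv ⟩
      K ℚ.* δ              ∎

  clamp : ℚ → ℚ
  clamp a = 1ℚ ℚ.⊔ a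

  1≤clamp : ∀ a → 1ℚ ℚ.≤ clamp a
  1≤clamp a = ℚ.p≤p⊔q 1ℚ a

  clamp-pos : ∀ a → ℚ.Positive (clamp a)
  clamp-pos a = ℚ.positive (ℚ.<-≤-trans (ℚ.positive⁻¹ 1ℚ) (1≤clamp a))

  recip : ℚ → ℚ
  recip a = (ℚ.1/ clamp a) {{ℚ.pos⇒nonZero (clamp a) {{clamp-pos a}}}}

  recip-pos : ∀ a → ℚ.Positive (recip a)
  recip-pos a = ℚ.1/pos⇒pos (clamp a) {{clamp-pos a}}

  recip-inverse : ∀ a → clamp a ℚ.* recip a ≡ 1ℚ
  recip-inverse a = ℚ.*-inverseʳ (clamp a) {{ℚ.pos⇒nonZero (clamp a) {{clamp-pos a}}}}

  recip≤1 : ∀ a → recip a ℚ.≤ 1ℚ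
  recip≤1 a = begin
    recip a                 ≡⟨ sym (ℚ.*-identityˡ (recip a)) ⟩
    1ℚ ℚ.* recip a          ≤⟨ ℚ.*-monoʳ-≤-nonNeg (recip a)
                                 {{ℚ.pos⇒nonNeg (recip a) {{recip-pos a}}}} (1≤clamp a) ⟩
    clamp a ℚ.* recip a     ≡⟨ recip-inverse a ⟩
    1ℚ                      ∎
    where open ℚ.≤-Reasoning

  |*recip|≤ : ∀ u a → ℚ.∣ u ℚ.* recip a ∣ ℚ.≤ ℚ.∣ u ∣
  |*recip|≤ u a = begin
    ℚ.∣ u ℚ.* recip a ∣          ≡⟨ ℚ.∣p*q∣≡∣p∣*∣q∣ u (recip a) ⟩
    ℚ.∣ u ∣ ℚ.* ℚ.∣ recip a ∣    ≡⟨ cong (ℚ.∣ u ∣ ℚ.*_) (ℚ.0≤p⇒∣p∣≡p (ℚ.<⇒≤ (ℚ.positive⁻¹ (recip a) {{recip-pos a}}))) ⟩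
    ℚ.∣ u ∣ ℚ.* recip a          ≤⟨ ℚ.*-monoˡ-≤-nonNeg ℚ.∣ u ∣ {{ℚ.∣-∣-nonNeg u}} (recip≤1 a) ⟩
    ℚ.∣ u ∣ ℚ.* 1ℚ               ≡⟨ ℚ.*-identityʳ ℚ.∣ u ∣ ⟩
    ℚ.∣ u ∣                      ∎
    where open ℚ.≤-Reasoning

  clamp-contract : ∀ a b → clamp a ℚ.- clamp b ℚ.≤ ℚ.∣ a ℚ.- b ∣
  clamp-contract a b = ≤+⇒-≤ (ℚ.⊔-lub
    (begin
      1ℚ                                   ≤⟨ 1≤clamp b ⟩
      clamp b                              ≡⟨ sym (ℚ.+-identityˡ (clamp b)) ⟩
      0ℚ ℚ.+ clamp b                       ≤⟨ ℚ.+-monoˡ-≤ (clamp b) (ℚ.0≤∣p∣ (a ℚ.- b)) ⟩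
      ℚ.∣ a ℚ.- b ∣ ℚ.+ clamp b            ∎)
    (begin
      a                                    ≤⟨ -≤⇒≤+ (x≤|x| (a ℚ.- b)) ⟩
      ℚ.∣ a ℚ.- b ∣ ℚ.+ b                  ≤⟨ ℚ.+-monoʳ-≤ ℚ.∣ a ℚ.- b ∣ (ℚ.p≤q⊔p 1ℚ b) ⟩
      ℚ.∣ a ℚ.- b ∣ ℚ.+ clamp b            ∎))
    where open ℚ.≤-Reasoning

  recip-contract : ∀ a b → ℚ.∣ recip a ℚ.- recip b ∣ ℚ.≤ ℚ.∣ a ℚ.- b ∣
  recip-contract a b = begin
    ℚ.∣ recip a ℚ.- recip b ∣
      ≡⟨ cong ℚ.∣_∣ (begin-equality
        recip a ℚ.- recip b
          ≡⟨ cong₂ ℚ._-_ (sym (ℚ.*-identityˡ (recip a))) (sym (ℚ.*-identityˡ (recip b))) ⟩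
        1ℚ ℚ.* recip a ℚ.- 1ℚ ℚ.* recip b
          ≡⟨ cong₂ (λ s t → s ℚ.* recip a ℚ.- t ℚ.* recip b) (sym (recip-inverse b)) (sym (recip-inverse a)) ⟩
        (clamp b ℚ.* recip b) ℚ.* recip a ℚ.- (clamp a ℚ.* recip a) ℚ.* recip b
          ≡⟨ solve 4 (λ A B r s → (B :* s) :* r :- (A :* r) :* s := ((B :- A) :* r) :* s)
               refl (clamp a) (clamp b) (recip a) (recip b) ⟩
        ((clamp b ℚ.- clamp a) ℚ.* recip a) ℚ.* recip b ∎) ⟩
    ℚ.∣ ((clamp b ℚ.- clamp a) ℚ.* recip a) ℚ.* recip b ∣
      ≤⟨ |*recip|≤ ((clamp b ℚ.- clamp a) ℚ.* recip a) b ⟩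
    ℚ.∣ (clamp b ℚ.- clamp a) ℚ.* recip a ∣
      ≤⟨ |*recip|≤ (clamp b ℚ.- clamp a) a ⟩
    ℚ.∣ clamp b ℚ.- clamp a ∣
      ≤⟨ |x|≤ (subst (clamp b ℚ.- clamp a ℚ.≤_) (|x-y|≡|y-x| b a) (clamp-contract b a))
           (subst (ℚ._≤ ℚ.∣ a ℚ.- b ∣)
             (solve 2 (λ A B → A :- B := :- (B :- A)) refl (clamp a) (clamp b)) (clamp-contract a b)) ⟩
    ℚ.∣ a ℚ.- b ∣ ∎
    where open ℚ.≤-Reasoning

-- Reals as Cauchy sequences of rationals, a setoid under _≃_.

record ℝ : Set where
  constructor mkℝ
  field
    seq    : ℕ → ℚ
    cauchy : ∀ ε → 0ℚ ℚ.< ε →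
             ∃[ N ] (∀ m n → N ℕ.≤ m → N ℕ.≤ n → ℚ.∣ seq m ℚ.- seq n ∣ ℚ.< ε)
open ℝ public

infix 4 _≃_ _<_ _≤_ _>_ _≥_

_≃_ : ℝ → ℝ → Set
x ≃ y = ∀ ε → 0ℚ ℚ.< ε → ∃[ N ] (∀ n → N ℕ.≤ n → ℚ.∣ seq x n ℚ.- seq y n ∣ ℚ.< ε)

-- A fixed rational gap is needed: pointwise eventual inequality of the
-- sequences is also possible between representatives of equal reals.
_<_ : ℝ → ℝ → Set
x < y = ∃[ ε ] (0ℚ ℚ.< ε × ∃[ N ] (∀ n → N ℕ.≤ n → seq x n ℚ.+ ε ℚ.≤ seq y n))

_≤_ : ℝ → ℝ → Set
x ≤ y = ¬ (y < x)

_>_ : ℝ → ℝ → Set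
x > y = y < x

_≥_ : ℝ → ℝ → Set
x ≥ y = y ≤ x

fromℚ : ℚ → ℝ
fromℚ r = mkℝ (λ _ → r)
  (λ ε 0<ε → 0 , λ _ _ _ _ → subst (ℚ._< ε) (cong ℚ.∣_∣ (sym (ℚ.+-inverseʳ r))) 0<ε)

fromℕ : ℕ → ℝ
fromℕ n = fromℚ ((+ n) ℚ./ 1)

0ℝ 1ℝ : ℝ
0ℝ = fromℚ 0ℚ
1ℝ = fromℚ 1ℚ

infix  8 -_
infixl 7 _*_
infixl 6 _+_ _-_

_+_ : ℝ → ℝ → ℝ
seq (x + y) n = seq x n ℚ.+ seq y n
cauchy (x + y) ε 0<ε =
  let (N₁ , h₁) = cauchy x (half ε) (half-pos 0<ε)
      (N₂ , h₂) = cauchy y (half ε) (half-pos 0<ε)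
  in N₁ ℕ.⊔ N₂ , λ m n N≤m N≤n → let open ℚ.≤-Reasoning in begin-strict
    ℚ.∣ (seq x m ℚ.+ seq y m) ℚ.- (seq x n ℚ.+ seq y n) ∣
      ≡⟨ cong ℚ.∣_∣ (solve 4 (λ a b c d → (a :+ b) :- (c :+ d) := (a :- c) :+ (b :- d))
           refl (seq x m) (seq y m) (seq x n) (seq y n)) ⟩
    ℚ.∣ (seq x m ℚ.- seq x n) ℚ.+ (seq y m ℚ.- seq y n) ∣
      ≤⟨ ℚ.∣p+q∣≤∣p∣+∣q∣ (seq x m ℚ.- seq x n) (seq y m ℚ.- seq y n) ⟩
    ℚ.∣ seq x m ℚ.- seq x n ∣ ℚ.+ ℚ.∣ seq y m ℚ.- seq y n ∣
      <⟨ ℚ.+-mono-< (h₁ m n (ℕ.m⊔n≤o⇒m≤o N₁ N₂ N≤m) (ℕ.m⊔n≤o⇒m≤o N₁ N₂ N≤n))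
                    (h₂ m n (ℕ.m⊔n≤o⇒n≤o N₁ N₂ N≤m) (ℕ.m⊔n≤o⇒n≤o N₁ N₂ N≤n)) ⟩
    half ε ℚ.+ half ε
      ≡⟨ half+half ε ⟩
    ε ∎

-_ : ℝ → ℝ
seq (- x) n = ℚ.- seq x n
cauchy (- x) ε 0<ε =
  let (N , h) = cauchy x ε 0<ε
  in N , λ m n N≤m N≤n → subst (ℚ._< ε)
    (cong ℚ.∣_∣ (solve 2 (λ a b → a :- b := :- b :- :- a) refl (seq x n) (seq x m)))
    (h n m N≤n N≤m)

_-_ : ℝ → ℝ → ℝ
x - y = x + (- y)

∣_∣ : ℝ → ℝ
seq ∣ x ∣ n = ℚ.∣ seq x n ∣
cauchy ∣ x ∣ ε 0<ε =
  let (N , h) = cauchy x ε 0<ε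
  in N , λ m n N≤m N≤n →
    ℚ.≤-<-trans (reverse-triangle (seq x m) (seq x n)) (h m n N≤m N≤n)

private
  eventually-bounded : ∀ x → ∃[ K ] (0ℚ ℚ.< K × ∃[ N ] (∀ n → N ℕ.≤ n → ℚ.∣ seq x n ∣ ℚ.≤ K))
  eventually-bounded x =
    let (N , h) = cauchy x 1ℚ (ℚ.positive⁻¹ 1ℚ)
        K = 1ℚ ℚ.+ ℚ.∣ seq x N ∣
    in K , ℚ.+-mono-<-≤ (ℚ.positive⁻¹ 1ℚ) (ℚ.0≤∣p∣ (seq x N)) , N , λ n N≤n →
      ℚ.≤-trans (|x|≤|x-y|+|y| (seq x n) (seq x N))
        (ℚ.+-monoˡ-≤ ℚ.∣ seq x N ∣ (ℚ.<⇒≤ (h n N N≤n ℕ.≤-refl)))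

  scale-down : ∀ K ε → 0ℚ ℚ.< K → 0ℚ ℚ.< ε → ∃[ δ ] (0ℚ ℚ.< δ × K ℚ.* δ ℚ.+ K ℚ.* δ ℚ.< ε)
  scale-down K ε 0<K 0<ε = go (half ε) (half-pos 0<ε) (half+half ε)
    where
    instance
      K>0 : ℚ.Positive K
      K>0 = ℚ.positive 0<K

      K≢0 : ℚ.NonZero K
      K≢0 = ℚ.pos⇒nonZero K

    module _ (i : ℚ) (K*i≡1 : K ℚ.* i ≡ 1ℚ) (i>0 : ℚ.Positive i) where
      open ℚ.≤-Reasoning

      K*[e*i]≡e : ∀ e → K ℚ.* (e ℚ.* i) ≡ e
      K*[e*i]≡e e = begin-equality
        K ℚ.* (e ℚ.* i)   ≡⟨ solve 3 (λ K e i → K :* (e :* i) := (K :* i) :* e) refl K e i ⟩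
        (K ℚ.* i) ℚ.* e   ≡⟨ cong (ℚ._* e) K*i≡1 ⟩
        1ℚ ℚ.* e          ≡⟨ ℚ.*-identityˡ e ⟩
        e                 ∎

      pos : ∀ {e} → 0ℚ ℚ.< e → 0ℚ ℚ.< e ℚ.* i
      pos {e} 0<e = subst (ℚ._< e ℚ.* i) (ℚ.*-zeroˡ i) (ℚ.*-monoˡ-<-pos i {{i>0}} 0<e)

    go : ∀ e → 0ℚ ℚ.< e → e ℚ.+ e ≡ ε → ∃[ δ ] (0ℚ ℚ.< δ × K ℚ.* δ ℚ.+ K ℚ.* δ ℚ.< ε)
    go e 0<e e+e≡ε = half e ℚ.* (ℚ.1/ K) ,
      pos (ℚ.1/ K) (ℚ.*-inverseʳ K) (ℚ.1/pos⇒pos K) (half-pos 0<e) ,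
      (begin-strict
        K ℚ.* (half e ℚ.* (ℚ.1/ K)) ℚ.+ K ℚ.* (half e ℚ.* (ℚ.1/ K))
          ≡⟨ cong₂ ℚ._+_ eq eq ⟩
        half e ℚ.+ half e  ≡⟨ half+half e ⟩
        e                  ≡⟨ sym (ℚ.+-identityʳ e) ⟩
        e ℚ.+ 0ℚ           <⟨ ℚ.+-monoʳ-< e 0<e ⟩
        e ℚ.+ e            ≡⟨ e+e≡ε ⟩
        ε                  ∎)
      where
      open ℚ.≤-Reasoning
      eq = K*[e*i]≡e (ℚ.1/ K) (ℚ.*-inverseʳ K) (ℚ.1/pos⇒pos K) (half e)

_*_ : ℝ → ℝ → ℝ
seq (x * y) n = seq x n ℚ.* seq y n
cauchy (x * y) ε 0<ε =
  let (A , 0<A , N₁ , boundA) = eventually-bounded x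
      (B , 0<B , N₂ , boundB) = eventually-bounded y
      K = A ℚ.+ B
      A≤K = subst (ℚ._≤ K) (ℚ.+-identityʳ A) (ℚ.+-monoʳ-≤ A (ℚ.<⇒≤ 0<B))
      B≤K = subst (ℚ._≤ K) (ℚ.+-identityˡ B) (ℚ.+-monoˡ-≤ B (ℚ.<⇒≤ 0<A))
      0<K = ℚ.<-≤-trans 0<A A≤K
      (δ , 0<δ , 2Kδ<ε) = scale-down K ε 0<K 0<ε
      (M₁ , h₁) = cauchy x δ 0<δ
      (M₂ , h₂) = cauchy y δ 0<δ
      N = N₁ ℕ.⊔ N₂
      M = M₁ ℕ.⊔ M₂
  in N ℕ.⊔ M , λ m n N⊔M≤m N⊔M≤n →
    let N≤m = ℕ.m⊔n≤o⇒m≤o N M N⊔M≤m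
        N≤n = ℕ.m⊔n≤o⇒m≤o N M N⊔M≤n
        M≤m = ℕ.m⊔n≤o⇒n≤o N M N⊔M≤m
        M≤n = ℕ.m⊔n≤o⇒n≤o N M N⊔M≤n
    in |product-difference| (seq x m) (seq x n) (seq y m) (seq y n)
         (ℚ.<⇒≤ 0<K)
         (ℚ.≤-trans (boundA m (ℕ.m⊔n≤o⇒m≤o N₁ N₂ N≤m)) A≤K)
         (ℚ.≤-trans (boundB n (ℕ.m⊔n≤o⇒n≤o N₁ N₂ N≤n)) B≤K)
         (ℚ.<⇒≤ (h₁ m n (ℕ.m⊔n≤o⇒m≤o M₁ M₂ M≤m) (ℕ.m⊔n≤o⇒m≤o M₁ M₂ M≤n)))
         (ℚ.<⇒≤ (h₂ m n (ℕ.m⊔n≤o⇒n≤o M₁ M₂ M≤m) (ℕ.m⊔n≤o⇒n≤o M₁ M₂ M≤n)))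
         2Kδ<ε

ℝ⁺ : Set
ℝ⁺ = Σ[ x ∈ ℝ ] 0ℝ < x

ℝ≥1 : Set
ℝ≥1 = Σ[ x ∈ ℝ ] 1ℝ ≤ x

infixl 6 _+⁺_

_+⁺_ : ℝ⁺ → ℝ⁺ → ℝ⁺
(x , ε , 0<ε , N , h) +⁺ (y , δ , 0<δ , M , k) =
  x + y , ε ℚ.+ δ , ℚ.+-mono-< 0<ε 0<δ , N ℕ.⊔ M , λ n N⊔M≤n →
    subst (ℚ._≤ seq x n ℚ.+ seq y n)
      (solve 2 (λ ε δ → (con 0ℚ :+ ε) :+ (con 0ℚ :+ δ) := con 0ℚ :+ (ε :+ δ)) refl ε δ)
      (ℚ.+-mono-≤ (h n (ℕ.m⊔n≤o⇒m≤o N M N⊔M≤n)) (k n (ℕ.m⊔n≤o⇒n≤o N M N⊔M≤n)))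

-- The entries of a representative of x ≥ 1 may lie below 1, or be 0, so they
-- are replaced by their maximum with 1 before inverting; _⁻¹-inverse shows
-- that this does give the reciprocal.
infix 8 _⁻¹

_⁻¹ : ℝ≥1 → ℝ
seq ((x , _) ⁻¹) n = (ℚ.1/ (1ℚ ℚ.⊔ seq x n))
  {{ℚ.pos⇒nonZero (1ℚ ℚ.⊔ seq x n) {{clamp-pos (seq x n)}}}}
cauchy ((x , _) ⁻¹) ε 0<ε =
  let (N , h) = cauchy x ε 0<ε
  in N , λ m n N≤m N≤n →
    ℚ.≤-<-trans (recip-contract (seq x m) (seq x n)) (h m n N≤m N≤n)

⁻¹-inverse : ∀ (x : ℝ≥1) → proj₁ x * x ⁻¹ ≃ 1ℝ
⁻¹-inverse (x , 1≤x) ε 0<ε with (N , h) ← cauchy x (half ε) (half-pos 0<ε) =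
  N , λ n N≤n → ℚ.≤-<-trans (close (seq x n)) (nearly n N≤n)
  where
  open ℚ.≤-Reasoning

  close : ∀ a → ℚ.∣ a ℚ.* recip a ℚ.- 1ℚ ∣ ℚ.≤ clamp a ℚ.- a
  close a = begin
    ℚ.∣ a ℚ.* recip a ℚ.- 1ℚ ∣
      ≡⟨ cong (λ t → ℚ.∣ a ℚ.* recip a ℚ.- t ∣) (sym (recip-inverse a)) ⟩
    ℚ.∣ a ℚ.* recip a ℚ.- clamp a ℚ.* recip a ∣
      ≡⟨ cong ℚ.∣_∣ (solve 3 (λ a c r → a :* r :- c :* r := (a :- c) :* r) refl a (clamp a) (recip a)) ⟩
    ℚ.∣ (a ℚ.- clamp a) ℚ.* recip a ∣
      ≤⟨ |*recip|≤ (a ℚ.- clamp a) a ⟩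
    ℚ.∣ a ℚ.- clamp a ∣
      ≡⟨ |x-y|≡|y-x| a (clamp a) ⟩
    ℚ.∣ clamp a ℚ.- a ∣
      ≡⟨ ℚ.0≤p⇒∣p∣≡p (subst (ℚ._≤ clamp a ℚ.- a) (ℚ.+-inverseʳ a)
           (ℚ.+-monoˡ-≤ (ℚ.- a) (ℚ.p≤q⊔p 1ℚ a))) ⟩
    clamp a ℚ.- a ∎

  lower : ∀ n → N ℕ.≤ n → 1ℚ ℚ.< ε ℚ.+ seq x n
  lower n N≤n with 1ℚ ℚ.<? ε ℚ.+ seq x n
  ... | yes 1<ε+xₙ = 1<ε+xₙ
  ... | no  1≮ε+xₙ = contradiction (half ε , half-pos 0<ε , N , below) 1≤x
    where
    below : ∀ m → N ℕ.≤ m → seq x m ℚ.+ half ε ℚ.≤ 1ℚ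
    below m N≤m = begin
      seq x m ℚ.+ half ε
        ≤⟨ ℚ.+-monoˡ-≤ (half ε) (-≤⇒≤+ {seq x m} {seq x n} (ℚ.≤-trans (x≤|x| (seq x m ℚ.- seq x n)) (ℚ.<⇒≤ (h m n N≤m N≤n)))) ⟩
      half ε ℚ.+ seq x n ℚ.+ half ε
        ≡⟨ solve 2 (λ e a → con ½ :* e :+ a :+ con ½ :* e := e :+ a) refl ε (seq x n) ⟩
      ε ℚ.+ seq x n
        ≤⟨ ℚ.≮⇒≥ 1≮ε+xₙ ⟩
      1ℚ ∎

  nearly : ∀ n → N ℕ.≤ n → clamp (seq x n) ℚ.- seq x n ℚ.< ε
  nearly n N≤n with ℚ.≤-total 1ℚ (seq x n)
  ... | inj₁ 1≤xₙ = begin-strict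
    clamp (seq x n) ℚ.- seq x n  ≡⟨ cong (ℚ._- seq x n) (ℚ.p≤q⇒p⊔q≡q 1≤xₙ) ⟩
    seq x n ℚ.- seq x n          ≡⟨ ℚ.+-inverseʳ (seq x n) ⟩
    0ℚ                           <⟨ 0<ε ⟩
    ε                            ∎
  ... | inj₂ xₙ≤1 = begin-strict
    clamp (seq x n) ℚ.- seq x n  ≡⟨ cong (ℚ._- seq x n) (ℚ.p≥q⇒p⊔q≡p xₙ≤1) ⟩
    1ℚ ℚ.- seq x n               <⟨ <+⇒-< (lower n N≤n) ⟩
    ε                            ∎

fromℕ≥1 : (q : ℕ) .{{_ : NonZero q}} → ℝ≥1
fromℕ≥1 q = fromℕ q , λ (ε , 0<ε , N , q+ε≤1) →
  let open ℚ.≤-Reasoning in ℚ.<-irrefl refl (begin-strict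
    1ℚ                      ≤⟨ 1≤q ⟩
    (+ q) ℚ./ 1             ≡⟨ sym (ℚ.+-identityʳ ((+ q) ℚ./ 1)) ⟩
    (+ q) ℚ./ 1 ℚ.+ 0ℚ      <⟨ ℚ.+-monoʳ-< ((+ q) ℚ./ 1) 0<ε ⟩
    (+ q) ℚ./ 1 ℚ.+ ε       ≤⟨ q+ε≤1 N ℕ.≤-refl ⟩
    1ℚ                      ∎)
  where
  1≤q : 1ℚ ℚ.≤ (+ q) ℚ./ 1
  1≤q = ℚ.toℚᵘ-cancel-≤ (ℚᵘ.≤-respʳ-≃ (ℚᵘ.≃-sym (ℚ.toℚᵘ-fromℚᵘ (ℚᵘ.mkℚᵘ (+ q) 0)))
    (ℚᵘ.*≤* (ℤ.*-monoʳ-≤-nonNeg (+ 1) (ℤ.+≤+ (ℕ.>-nonZero⁻¹ q)))))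

-- "For all sufficiently large x", with x ranging over x ≥ 1.
Eventually : (ℝ≥1 → Set) → Set
Eventually P = ∃[ X ] (∀ (x : ℝ≥1) → X ≤ proj₁ x → P x)

LittleO : (g h : ℝ≥1 → ℝ) → Set
LittleO g h = ∀ (η : ℝ⁺) → Eventually λ x → ∣ g x ∣ ≤ proj₁ η * ∣ h x ∣

-- The field value-cong says that value is a function of real numbers, not of their
-- representatives or of the proofs that they lie in its domain.
record IrrationalityMeasure : Set where
  field
    value        : ℝ≥1 → ℝ⁺ → ℝ⁺
    value-cong   : ∀ {x y μ ν} → proj₁ x ≃ proj₁ y → proj₁ μ ≃ proj₁ ν →
                   proj₁ (value x μ) ≃ proj₁ (value y ν)
    decreasing-x : ∀ {x y} μ → proj₁ x < proj₁ y → proj₁ (value y μ) < proj₁ (value x μ)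
    decreasing-λ : ∀ x {μ ν} → proj₁ μ < proj₁ ν → proj₁ (value x ν) < proj₁ (value x μ)

  at : ℝ⁺ → ℝ≥1 → ℝ⁺
  at μ x = value x μ

Irrational : ℝ → Set
Irrational α = ∀ (p : ℤ) (q : ℕ) .{{_ : NonZero q}} → ¬ (α ≃ fromℚ (p ℚ./ q))

module _ (f : IrrationalityMeasure) where
  open IrrationalityMeasure f

  Admissible : ℝ → ℝ⁺ → Set
  Admissible α μ = ∀ (ε : ℝ⁺) → Σ[ Q ∈ ℕ ] NonZero Q ×
    (∀ (p : ℤ) (q : ℕ) .{{_ : NonZero q}} → q ℕ.≥ Q →
      ∣ α - fromℚ (p ℚ./ q) ∣ > proj₁ (value (fromℕ≥1 q) (μ +⁺ ε)))

  -- λ(α) = μ, the least admissible value.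
  HasIrrationalityMeasure : ℝ → ℝ⁺ → Set
  HasIrrationalityMeasure α μ =
    Admissible α μ × (∀ (ν : ℝ⁺) → Admissible α ν → proj₁ μ ≤ proj₁ ν)

ApproximableToOrder : ℝ → (ℝ≥1 → ℝ⁺) → Set
ApproximableToOrder θ ω = ∀ (C : ℝ⁺) →
  Σ[ p ∈ ℤ ] Σ[ q ∈ ℕ ] Σ[ q≢0 ∈ NonZero q ] let instance _ = q≢0 in
    fromℕ q > proj₁ C × ∣ θ - fromℚ (p ℚ./ q) ∣ < proj₁ (ω (fromℕ≥1 q))

{-# OPTIONS --safe #-}
module Submission where

-- θ is the common limit of a Stern–Brocot path of Farey intervals (p/q , e/d), whose left endpoints
-- increase to θ with 1/(q q⁺) ≤ θ − p/q ≤ 1/(q d⁺), where q⁺ and d⁺ = q⁺ − q are the next denominators.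
-- The numbers of left turns are chosen so that d⁺ ≈ 1/(q f(q,λ)).  Both bounds are then f(q,λ) up to a
-- factor tending to 1, because q² f(q,λ) → 0: the upper one gives approximability to order f(·,λ), which
-- makes λ minimal, and the lower one exceeds f(q,λ+ε).  A fraction P/Q that is not a left endpoint is
-- at distance at least 1/(8Q²) from θ, by comparison with the first p/q such that 2Q ≤ d⁺; this exceeds
-- f(Q,λ) for large Q.

open import Defs
open import Data.Nat as ℕ using (ℕ; zero; suc; NonZero)
import Data.Nat.Properties as ℕ
import Data.Nat.Divisibility as ℕ
import Data.Nat.Tactic.RingSolver as ℕ-Ring
open import Data.Integer as ℤ using (ℤ; +_; -[1+_]; 1ℤ)
import Data.Integer.Properties as ℤ
import Data.Integer.Tactic.RingSolver as ℤ-Ring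
open import Data.Rational as ℚ using (ℚ; 0ℚ; 1ℚ; ½)
import Data.Rational.Properties as ℚ
import Data.Rational.Solver as ℚ
import Data.Rational.Unnormalised as ℚᵘ
import Data.Rational.Unnormalised.Properties as ℚᵘ
open import Data.Product using (∃-syntax; Σ-syntax; _×_; _,_; proj₁; proj₂)
open import Data.Sum using (_⊎_; inj₁; inj₂; [_,_]′)
open import Relation.Binary using (Tri; tri<; tri≈; tri>)
open import Relation.Nullary using (¬_; yes; no; contradiction)
open import Relation.Binary.PropositionalEquality
  using (_≡_; refl; sym; trans; cong; subst; subst₂; module ≡-Reasoning)

open ℚ.+-*-Solver using (solve; _:=_; _:+_; _:-_; _:*_; :-_; con)

-- Rational numbers

toℚᵘ-/ : ∀ i n .{{_ : NonZero n}} → ℚ.toℚᵘ (i ℚ./ n) ℚᵘ.≃ i ℚᵘ./ n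
toℚᵘ-/ i (suc n) = ℚ.toℚᵘ-fromℚᵘ (ℚᵘ.mkℚᵘ i n)

/-mono-≤ : ∀ i m j n .{{_ : NonZero m}} .{{_ : NonZero n}} →
           i ℤ.* + n ℤ.≤ j ℤ.* + m → i ℚ./ m ℚ.≤ j ℚ./ n
/-mono-≤ i m@(suc _) j n@(suc _) h = ℚ.toℚᵘ-cancel-≤
  (ℚᵘ.≤-respˡ-≃ (ℚᵘ.≃-sym (toℚᵘ-/ i m)) (ℚᵘ.≤-respʳ-≃ (ℚᵘ.≃-sym (toℚᵘ-/ j n)) (ℚᵘ.*≤* h)))

/-mono-< : ∀ i m j n .{{_ : NonZero m}} .{{_ : NonZero n}} →
           i ℤ.* + n ℤ.< j ℤ.* + m → i ℚ./ m ℚ.< j ℚ./ n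
/-mono-< i m@(suc _) j n@(suc _) h = ℚ.toℚᵘ-cancel-<
  (ℚᵘ.<-respˡ-≃ (ℚᵘ.≃-sym (toℚᵘ-/ i m)) (ℚᵘ.<-respʳ-≃ (ℚᵘ.≃-sym (toℚᵘ-/ j n)) (ℚᵘ.*<* h)))

/-cross : ∀ i m j n .{{_ : NonZero m}} .{{_ : NonZero n}} →
          i ℤ.* + n ≡ j ℤ.* + m → i ℚ./ m ≡ j ℚ./ n
/-cross i m j n eq = ℚ.≤-antisym (/-mono-≤ i m j n (ℤ.≤-reflexive eq))
                                 (/-mono-≤ j n i m (ℤ.≤-reflexive (sym eq)))

/-homo-+ : ∀ i m j n .{{_ : NonZero m}} .{{_ : NonZero n}} .{{_ : NonZero (m ℕ.* n)}} →
           i ℚ./ m ℚ.+ j ℚ./ n ≡ (i ℤ.* + n ℤ.+ j ℤ.* + m) ℚ./ (m ℕ.* n)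
/-homo-+ i m@(suc _) j n@(suc _) = ℚ.toℚᵘ-injective (ℚᵘ.≃-trans (ℚ.toℚᵘ-homo-+ (i ℚ./ m) (j ℚ./ n))
  (ℚᵘ.≃-trans (ℚᵘ.+-cong (toℚᵘ-/ i m) (toℚᵘ-/ j n))
    (ℚᵘ.≃-sym (toℚᵘ-/ (i ℤ.* + n ℤ.+ j ℤ.* + m) (m ℕ.* n)))))

/-homo-* : ∀ i m j n .{{_ : NonZero m}} .{{_ : NonZero n}} .{{_ : NonZero (m ℕ.* n)}} →
           (i ℚ./ m) ℚ.* (j ℚ./ n) ≡ (i ℤ.* j) ℚ./ (m ℕ.* n)
/-homo-* i m@(suc _) j n@(suc _) = ℚ.toℚᵘ-injective (ℚᵘ.≃-trans (ℚ.toℚᵘ-homo-* (i ℚ./ m) (j ℚ./ n))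
  (ℚᵘ.≃-trans (ℚᵘ.*-cong (toℚᵘ-/ i m) (toℚᵘ-/ j n))
    (ℚᵘ.≃-sym (toℚᵘ-/ (i ℤ.* j) (m ℕ.* n)))))

-- unit n is 1/n, with the junk value unit 0 = 1 for which it is antitone on all of ℕ.
unit : ℕ → ℚ
unit n = 1ℤ ℚ./ suc (ℕ.pred n)

unit-nonZero : ∀ n .{{_ : NonZero n}} → unit n ≡ 1ℤ ℚ./ n
unit-nonZero (suc _) = refl

unit-anti-≤ : ∀ {m n} → m ℕ.≤ n → unit n ℚ.≤ unit m
unit-anti-≤ {m} {n} m≤n = /-mono-≤ 1ℤ (suc (ℕ.pred n)) 1ℤ (suc (ℕ.pred m))
  (ℤ.*-monoˡ-≤-nonNeg 1ℤ (ℤ.+≤+ (ℕ.s≤s (ℕ.pred-mono-≤ m≤n))))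

unit-anti-< : ∀ {m n} .{{_ : NonZero m}} → m ℕ.< n → unit n ℚ.< unit m
unit-anti-< {suc m} {suc n} (ℕ.s≤s m<n) = /-mono-< 1ℤ (suc n) 1ℤ (suc m)
  (ℤ.*-monoˡ-<-pos 1ℤ (ℤ.+<+ (ℕ.s≤s m<n)))

unit>0 : ∀ n → 0ℚ ℚ.< unit n
unit>0 n = ℚ.positive⁻¹ (unit n) {{ℚ.normalize-pos 1 (suc (ℕ.pred n))}}

-- Serves to split the gap 1/(qQ) between two distinct fractions into equal halves.
unit-double : ∀ n .{{_ : NonZero n}} → unit (n ℕ.* 2) ℚ.+ unit (n ℕ.* 2) ≡ unit n
unit-double n@(suc _) = trans (/-homo-+ 1ℤ (n ℕ.* 2) 1ℤ (n ℕ.* 2))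
  (/-cross (1ℤ ℤ.* + (n ℕ.* 2) ℤ.+ 1ℤ ℤ.* + (n ℕ.* 2)) (n ℕ.* 2 ℕ.* (n ℕ.* 2)) 1ℤ n eq)
  where
  identity : ∀ k → (1ℤ ℤ.* (k ℤ.* + 2) ℤ.+ 1ℤ ℤ.* (k ℤ.* + 2)) ℤ.* k ≡ 1ℤ ℤ.* (k ℤ.* + 2 ℤ.* (k ℤ.* + 2))
  identity = ℤ-Ring.solve-∀

  eq : (1ℤ ℤ.* + (n ℕ.* 2) ℤ.+ 1ℤ ℤ.* + (n ℕ.* 2)) ℤ.* + n ≡ 1ℤ ℤ.* + (n ℕ.* 2 ℕ.* (n ℕ.* 2))
  eq = subst₂ (λ u v → (1ℤ ℤ.* u ℤ.+ 1ℤ ℤ.* u) ℤ.* + n ≡ 1ℤ ℤ.* v) (sym (ℤ.pos-* n 2))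
    (trans (cong (λ u → u ℤ.* u) (sym (ℤ.pos-* n 2))) (sym (ℤ.pos-* (n ℕ.* 2) (n ℕ.* 2)))) (identity (+ n))

module _ (i : ℤ) (m : ℕ) (j : ℤ) (n : ℕ) .{{_ : NonZero m}} .{{_ : NonZero n}} where

  private
    instance
      mn≢0 : NonZero (m ℕ.* n)
      mn≢0 = ℕ.m*n≢0 m n

      mmn≢0 : NonZero (m ℕ.* (m ℕ.* n))
      mmn≢0 = ℕ.m*n≢0 m (m ℕ.* n)

    identity₁ : ∀ i m n → (i ℤ.* (m ℤ.* n) ℤ.+ 1ℤ ℤ.* m) ℤ.* (m ℤ.* n) ≡ (i ℤ.* n ℤ.+ 1ℤ) ℤ.* (m ℤ.* (m ℤ.* n))
    identity₁ = ℤ-Ring.solve-∀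

    eq₁ : (i ℤ.* + (m ℕ.* n) ℤ.+ 1ℤ ℤ.* + m) ℤ.* + (m ℕ.* n) ≡ (i ℤ.* + n ℤ.+ 1ℤ) ℤ.* + (m ℕ.* (m ℕ.* n))
    eq₁ = subst₂ (λ u v → (i ℤ.* u ℤ.+ 1ℤ ℤ.* + m) ℤ.* u ≡ (i ℤ.* + n ℤ.+ 1ℤ) ℤ.* v) (sym (ℤ.pos-* m n))
      (trans (cong (+ m ℤ.*_) (sym (ℤ.pos-* m n))) (sym (ℤ.pos-* m (m ℕ.* n)))) (identity₁ i (+ m) (+ n))

    /-+-unit : i ℚ./ m ℚ.+ unit (m ℕ.* n) ≡ (i ℤ.* + n ℤ.+ 1ℤ) ℚ./ (m ℕ.* n)
    /-+-unit = trans (cong (i ℚ./ m ℚ.+_) (unit-nonZero (m ℕ.* n)))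
      (trans (/-homo-+ i m 1ℤ (m ℕ.* n))
        (/-cross (i ℤ.* + (m ℕ.* n) ℤ.+ 1ℤ ℤ.* + m) (m ℕ.* (m ℕ.* n)) (i ℤ.* + n ℤ.+ 1ℤ) (m ℕ.* n) eq₁))

    identity₂ : ∀ j m n → j ℤ.* (m ℤ.* n) ≡ (j ℤ.* m) ℤ.* n
    identity₂ = ℤ-Ring.solve-∀

    eq₂ : j ℤ.* + (m ℕ.* n) ≡ (j ℤ.* + m) ℤ.* + n
    eq₂ = trans (cong (j ℤ.*_) (ℤ.pos-* m n)) (identity₂ j (+ m) (+ n))

  -- Over the common denominator mn the two sides have numerators in + 1 and jm. For distinct
  -- fractions this gives the separation by at least 1/(mn).
  /-gap-≤ : i ℤ.* + n ℤ.+ 1ℤ ℤ.≤ j ℤ.* + m → i ℚ./ m ℚ.+ unit (m ℕ.* n) ℚ.≤ j ℚ./ n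
  /-gap-≤ h = subst (ℚ._≤ j ℚ./ n) (sym /-+-unit)
    (/-mono-≤ (i ℤ.* + n ℤ.+ 1ℤ) (m ℕ.* n) j n
      (subst ((i ℤ.* + n ℤ.+ 1ℤ) ℤ.* + n ℤ.≤_) (sym eq₂) (ℤ.*-monoʳ-≤-nonNeg (+ n) h)))

  /-gap-≥ : j ℤ.* + m ℤ.≤ i ℤ.* + n ℤ.+ 1ℤ → j ℚ./ n ℚ.≤ i ℚ./ m ℚ.+ unit (m ℕ.* n)
  /-gap-≥ h = subst (j ℚ./ n ℚ.≤_) (sym /-+-unit)
    (/-mono-≤ j n (i ℤ.* + n ℤ.+ 1ℤ) (m ℕ.* n)
      (subst (ℤ._≤ (i ℤ.* + n ℤ.+ 1ℤ) ℤ.* + n) (sym eq₂) (ℤ.*-monoʳ-≤-nonNeg (+ n) h)))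

∃unit< : ∀ {ε} → 0ℚ ℚ.< ε → ∃[ n ] unit (suc n) ℚ.< ε
-- The numerator `i` is at least 1, so ε is at least 1/(d + 1) and exceeds 1/(d + 2).
∃unit< {ε@(ℚ.mkℚ i d _)} 0<ε = suc d , subst (unit (suc (suc d)) ℚ.<_) (ℚ.↥p/↧p≡p ε)
  (/-mono-< 1ℤ (suc (suc d)) i (suc d) (positive-numerator i (ℚ.positive 0<ε)))
  where
  positive-numerator : ∀ i → ℤ.Positive i → 1ℤ ℤ.* + suc d ℤ.< i ℤ.* + suc (suc d)
  positive-numerator (+ suc k) _ = ℤ.<-≤-trans
    (ℤ.+<+ (subst (ℕ._< suc (suc d)) (sym (ℕ.*-identityˡ (suc d))) (ℕ.n<1+n (suc d))))
    (ℤ.+≤+ (ℕ.m≤m+n (suc (suc d)) (k ℕ.* suc (suc d))))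

∣∣-lub : ∀ {x y} → x ℚ.≤ y → ℚ.- x ℚ.≤ y → ℚ.∣ x ∣ ℚ.≤ y
∣∣-lub {x} x≤y -x≤y with ℚ.∣p∣≡p∨∣p∣≡-p x
... | inj₁ e = subst (ℚ._≤ _) (sym e) x≤y
... | inj₂ e = subst (ℚ._≤ _) (sym e) -x≤y

steps⇒mono : ∀ {A : Set} {_R_ : A → A → Set} (s : ℕ → A) → (∀ {x} → x R x) →
             (∀ {x y z} → x R y → y R z → x R z) → (∀ n → s n R s (suc n)) →
             ∀ {m n} → m ℕ.≤ n → s m R s n
steps⇒mono {_R_ = _R_} s R-refl R-trans step m≤n = go (ℕ.≤⇒≤′ m≤n)
  where
  go : ∀ {m n} → m ℕ.≤′ n → s m R s n
  go ℕ.≤′-refl = R-refl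
  go (ℕ.≤′-step m≤n) = R-trans (go m≤n) (step _)

p≤p+q : ∀ {p q} → 0ℚ ℚ.≤ q → p ℚ.≤ p ℚ.+ q
p≤p+q {p} 0≤q = subst (ℚ._≤ p ℚ.+ _) (ℚ.+-identityʳ p) (ℚ.+-monoʳ-≤ p 0≤q)

x≤a+w⇒x-a≤w : ∀ {x a w} → x ℚ.≤ a ℚ.+ w → x ℚ.- a ℚ.≤ w
x≤a+w⇒x-a≤w {x} {a} {w} h = subst (x ℚ.- a ℚ.≤_)
  (solve 2 (λ a w → a :+ w :- a := w) refl a w) (ℚ.+-monoˡ-≤ (ℚ.- a) h)

a+w≤x⇒w≤x-a : ∀ {x a w} → a ℚ.+ w ℚ.≤ x → w ℚ.≤ x ℚ.- a
a+w≤x⇒w≤x-a {x} {a} {w} h = subst (ℚ._≤ x ℚ.- a)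
  (solve 2 (λ a w → a :+ w :- a := w) refl a w) (ℚ.+-monoˡ-≤ (ℚ.- a) h)

-[x-y]≡y-x : ∀ x y → ℚ.- (x ℚ.- y) ≡ y ℚ.- x
-[x-y]≡y-x = solve 2 (λ x y → :- (x :- y) := y :- x) refl

x≤∣x∣ : ∀ x → x ℚ.≤ ℚ.∣ x ∣
x≤∣x∣ x with ℚ.≤-total 0ℚ x
... | inj₁ 0≤x = ℚ.≤-reflexive (sym (ℚ.0≤p⇒∣p∣≡p 0≤x))
... | inj₂ x≤0 = ℚ.≤-trans x≤0 (ℚ.0≤∣p∣ x)

∣x-y∣≤ : ∀ {x y w} → x ℚ.≤ y ℚ.+ w → y ℚ.≤ x ℚ.+ w → ℚ.∣ x ℚ.- y ∣ ℚ.≤ w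
∣x-y∣≤ {x} {y} {w} x≤y+w y≤x+w = ∣∣-lub (x≤a+w⇒x-a≤w {x} {y} {w} x≤y+w)
  (subst (ℚ._≤ w) (sym (-[x-y]≡y-x x y)) (x≤a+w⇒x-a≤w {y} {x} {w} y≤x+w))

≤∣x-y∣ : ∀ {x y w} → y ℚ.+ w ℚ.≤ x ⊎ x ℚ.+ w ℚ.≤ y → w ℚ.≤ ℚ.∣ x ℚ.- y ∣
≤∣x-y∣ {x} {y} {w} (inj₁ h) = ℚ.≤-trans (a+w≤x⇒w≤x-a {x} {y} {w} h) (x≤∣x∣ (x ℚ.- y))
≤∣x-y∣ {x} {y} {w} (inj₂ h) = ℚ.≤-trans (a+w≤x⇒w≤x-a {y} {x} {w} h)
  (ℚ.≤-trans (x≤∣x∣ (y ℚ.- x)) (ℚ.≤-reflexive (trans (cong ℚ.∣_∣ (sym (-[x-y]≡y-x x y))) (ℚ.∣-p∣≡∣p∣ (x ℚ.- y)))))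

pos-*-suc : ∀ {k l m n} → k ℕ.* l ≡ suc (m ℕ.* n) → + k ℤ.* + l ≡ + m ℤ.* + n ℤ.+ 1ℤ
pos-*-suc {k} {l} {m} {n} eq = begin
  + k ℤ.* + l             ≡⟨ sym (ℤ.pos-* k l) ⟩
  + (k ℕ.* l)             ≡⟨ cong +_ (trans eq (ℕ.+-comm 1 (m ℕ.* n))) ⟩
  + (m ℕ.* n) ℤ.+ 1ℤ      ≡⟨ cong (ℤ._+ 1ℤ) (ℤ.pos-* m n) ⟩
  + m ℤ.* + n ℤ.+ 1ℤ      ∎
  where open ≡-Reasoning

i<j⇒i+1≤j : ∀ {i j} → i ℤ.< j → i ℤ.+ 1ℤ ℤ.≤ j
i<j⇒i+1≤j {i} i<j = subst (ℤ._≤ _) (ℤ.+-comm 1ℤ i) (ℤ.i<j⇒suc[i]≤j i<j)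

/-monoℕ-≤ : ∀ k l m n .{{_ : NonZero l}} .{{_ : NonZero n}} →
            k ℕ.* n ℕ.≤ m ℕ.* l → + k ℚ./ l ℚ.≤ + m ℚ./ n
/-monoℕ-≤ k l m n h = /-mono-≤ (+ k) l (+ m) n
  (subst₂ ℤ._≤_ (ℤ.pos-* k n) (ℤ.pos-* m l) (ℤ.+≤+ h))

-- The path which, at an interval (p/q , e/d), replaces the right endpoint by its mediant with the left one
-- suc (a q) times, and then the left endpoint once.

module SternBrocot (a : ℕ → ℕ) where

  p q e d : ℕ → ℕ
  p zero = 0
  p (suc n) = p n ℕ.+ e (suc n)
  q zero = 1
  q (suc n) = q n ℕ.+ d (suc n)
  e zero = 1
  e (suc n) = suc (a (q n)) ℕ.* p n ℕ.+ e n
  d zero = 1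
  d (suc n) = suc (a (q n)) ℕ.* q n ℕ.+ d n

  -- Growth of the denominators

  1≤d : ∀ n → 1 ℕ.≤ d n
  1≤d zero = ℕ.≤-refl
  1≤d (suc n) = ℕ.≤-trans (1≤d n) (ℕ.m≤n+m (d n) (suc (a (q n)) ℕ.* q n))

  -- This crude growth suffices for the Cauchy property, for unbounded denominators of good
  -- approximations, and for turning a bound on `q n` into one on `n`.
  n<q : ∀ n → n ℕ.< q n
  n<q zero = ℕ.≤-refl
  n<q (suc n) = subst (ℕ._≤ q (suc n)) (ℕ.+-comm (suc n) 1) (ℕ.+-mono-≤ (n<q n) (1≤d (suc n)))

  q-nonZero : ∀ n → NonZero (q n)
  q-nonZero n = ℕ.>-nonZero (ℕ.≤-trans (ℕ.s≤s ℕ.z≤n) (n<q n))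

  d-nonZero : ∀ n → NonZero (d n)
  d-nonZero n = ℕ.>-nonZero (1≤d n)

  q*≤d : ∀ n → suc (a (q n)) ℕ.* q n ℕ.≤ d (suc n)
  q*≤d n = ℕ.m≤m+n (suc (a (q n)) ℕ.* q n) (d n)

  q≤d : ∀ n → q n ℕ.≤ d (suc n)
  q≤d n = ℕ.≤-trans (ℕ.m≤m+n (q n) (a (q n) ℕ.* q n)) (q*≤d n)

  d≤q : ∀ n → d n ℕ.≤ q n
  d≤q zero = ℕ.≤-refl
  d≤q (suc n) = ℕ.m≤n+m (d (suc n)) (q n)

  -- Each stage replaces the right endpoint at least once before the left one, so the right
  -- denominator never drops below half of the left one.
  q≤2d : ∀ n → q n ℕ.≤ d n ℕ.+ d n
  q≤2d zero = ℕ.s≤s ℕ.z≤n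
  q≤2d (suc n) = ℕ.+-monoˡ-≤ (d (suc n)) (q≤d n)

  q-mono : ∀ {m n} → m ℕ.≤ n → q m ℕ.≤ q n
  q-mono = steps⇒mono {_R_ = ℕ._≤_} q ℕ.≤-refl ℕ.≤-trans (λ n → ℕ.m≤m+n (q n) (d (suc n)))

  -- Taking a mediant adds one column of the matrix of endpoints to the other, so its determinant
  -- stays 1. `det-mixed` is the intermediate stage at which only the right endpoint has moved. The
  -- `suc` stands in for a subtraction.
  det : ∀ n → e n ℕ.* q n ≡ suc (p n ℕ.* d n)
  det-mixed : ∀ n → e (suc n) ℕ.* q n ≡ suc (p n ℕ.* d (suc n))

  det zero = refl
  det (suc n) = begin
    e (suc n) ℕ.* (q n ℕ.+ d (suc n))                    ≡⟨ ℕ.*-distribˡ-+ (e (suc n)) (q n) (d (suc n)) ⟩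
    e (suc n) ℕ.* q n ℕ.+ e (suc n) ℕ.* d (suc n)        ≡⟨ cong (ℕ._+ e (suc n) ℕ.* d (suc n)) (det-mixed n) ⟩
    suc (p n ℕ.* d (suc n) ℕ.+ e (suc n) ℕ.* d (suc n))  ≡⟨ cong suc (sym (ℕ.*-distribʳ-+ (d (suc n)) (p n) (e (suc n)))) ⟩
    suc ((p n ℕ.+ e (suc n)) ℕ.* d (suc n))              ∎
    where open ≡-Reasoning

  det-mixed n = begin
    (m ℕ.* p n ℕ.+ e n) ℕ.* q n             ≡⟨ ℕ.*-distribʳ-+ (q n) (m ℕ.* p n) (e n) ⟩
    m ℕ.* p n ℕ.* q n ℕ.+ e n ℕ.* q n       ≡⟨ cong (m ℕ.* p n ℕ.* q n ℕ.+_) (det n) ⟩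
    m ℕ.* p n ℕ.* q n ℕ.+ suc (p n ℕ.* d n) ≡⟨ identity m (p n) (q n) (d n) ⟩
    suc (p n ℕ.* (m ℕ.* q n ℕ.+ d n))       ∎
    where
    open ≡-Reasoning
    m = suc (a (q n))
    identity : ∀ m p q d → m ℕ.* p ℕ.* q ℕ.+ suc (p ℕ.* d) ≡ suc (p ℕ.* (m ℕ.* q ℕ.+ d))
    identity = ℕ-Ring.solve-∀

  -- The new left endpoint is the mediant of the old one and the new right endpoint, hence again a
  -- Farey neighbour of the old one.
  det-left : ∀ n → p (suc n) ℕ.* q n ≡ suc (p n ℕ.* q (suc n))
  det-left n = begin
    (p n ℕ.+ e (suc n)) ℕ.* q n                ≡⟨ ℕ.*-distribʳ-+ (q n) (p n) (e (suc n)) ⟩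
    p n ℕ.* q n ℕ.+ e (suc n) ℕ.* q n          ≡⟨ cong (p n ℕ.* q n ℕ.+_) (det-mixed n) ⟩
    p n ℕ.* q n ℕ.+ suc (p n ℕ.* d (suc n))    ≡⟨ identity (p n) (q n) (d (suc n)) ⟩
    suc (p n ℕ.* (q n ℕ.+ d (suc n)))          ∎
    where
    open ≡-Reasoning
    identity : ∀ p q d → p ℕ.* q ℕ.+ suc (p ℕ.* d) ≡ suc (p ℕ.* (q ℕ.+ d))
    identity = ℕ-Ring.solve-∀

  -- The endpoints and their limit

  left right : ℕ → ℚ
  left n = (+ p n ℚ./ q n) {{q-nonZero n}}
  right n = (+ e n ℚ./ d n) {{d-nonZero n}}

  left-gap : ∀ n → left n ℚ.+ unit (q n ℕ.* q (suc n)) ℚ.≤ left (suc n)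
  left-gap n = /-gap-≤ (+ p n) (q n) (+ p (suc n)) (q (suc n)) {{q-nonZero n}} {{q-nonZero (suc n)}} (ℤ.≤-reflexive (sym
    (pos-*-suc {p (suc n)} {q n} {p n} {q (suc n)} (det-left n))))

  right-gap : ∀ n → right (suc n) ℚ.≤ left n ℚ.+ unit (q n ℕ.* d (suc n))
  right-gap n = /-gap-≥ (+ p n) (q n) (+ e (suc n)) (d (suc n)) {{q-nonZero n}} {{d-nonZero (suc n)}} (ℤ.≤-reflexive
    (pos-*-suc {e (suc n)} {q n} {p n} {d (suc n)} (det-mixed n)))

  left-mono : ∀ {m n} → m ℕ.≤ n → left m ℚ.≤ left n
  left-mono = steps⇒mono {_R_ = ℚ._≤_} left ℚ.≤-refl ℚ.≤-trans λ n →
    /-monoℕ-≤ (p n) (q n) (p (suc n)) (q (suc n)) {{q-nonZero n}} {{q-nonZero (suc n)}}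
    (ℕ.≤-trans (ℕ.n≤1+n _) (ℕ.≤-reflexive (sym (det-left n))))

  pd≤eq : ∀ n → p n ℕ.* d n ℕ.≤ e n ℕ.* q n
  pd≤eq n = ℕ.≤-trans (ℕ.n≤1+n _) (ℕ.≤-reflexive (sym (det n)))

  right-anti : ∀ {m n} → m ℕ.≤ n → right n ℚ.≤ right m
  right-anti = steps⇒mono {_R_ = ℚ._≥_} right ℚ.≤-refl (λ h k → ℚ.≤-trans k h) λ n →
    /-monoℕ-≤ (e (suc n)) (d (suc n)) (e n) (d n) {{d-nonZero (suc n)}} {{d-nonZero n}}
      (step (suc (a (q n))) (p n) (q n) (e n) (d n) (pd≤eq n))
    where
    step : ∀ m p q e d → p ℕ.* d ℕ.≤ e ℕ.* q → (m ℕ.* p ℕ.+ e) ℕ.* d ℕ.≤ e ℕ.* (m ℕ.* q ℕ.+ d)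
    step m p q e d h = subst₂ ℕ._≤_ (identity₁ m p e d) (identity₂ m q e d)
      (ℕ.+-monoˡ-≤ (e ℕ.* d) (ℕ.*-monoʳ-≤ m h))
      where
      identity₁ : ∀ m p e d → m ℕ.* (p ℕ.* d) ℕ.+ e ℕ.* d ≡ (m ℕ.* p ℕ.+ e) ℕ.* d
      identity₁ = ℕ-Ring.solve-∀
      identity₂ : ∀ m q e d → m ℕ.* (e ℕ.* q) ℕ.+ e ℕ.* d ≡ e ℕ.* (m ℕ.* q ℕ.+ d)
      identity₂ = ℕ-Ring.solve-∀

  left≤right : ∀ n → left n ℚ.≤ right n
  left≤right n = /-monoℕ-≤ (p n) (q n) (e n) (d n) {{q-nonZero n}} {{d-nonZero n}} (pd≤eq n)

  left-lower : ∀ {n j} → n ℕ.< j → left n ℚ.+ unit (q n ℕ.* q (suc n)) ℚ.≤ left j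
  left-lower {n} n<j = ℚ.≤-trans (left-gap n) (left-mono n<j)

  -- Every later left endpoint lies below `right (suc n)`, which is a Farey neighbour of `left n` at
  -- distance 1/(q d⁺).
  left-upper : ∀ {n j} → n ℕ.< j → left j ℚ.≤ left n ℚ.+ unit (q n ℕ.* d (suc n))
  left-upper {n} {j} n<j = ℚ.≤-trans (left≤right j) (ℚ.≤-trans (right-anti n<j) (right-gap n))

  convergent-far : ∀ {n j} → n ℕ.< j → unit (q n ℕ.* q (suc n)) ℚ.≤ ℚ.∣ left j ℚ.- left n ∣
  convergent-far {n} {j} n<j = ≤∣x-y∣ {left j} {left n} (inj₁ (left-lower n<j))

  convergent-near : ∀ {n j} → n ℕ.< j → ℚ.∣ left j ℚ.- left n ∣ ℚ.≤ unit (q n ℕ.* d (suc n))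
  convergent-near {n} {j} n<j = ∣x-y∣≤ {left j} {left n} (left-upper n<j)
    (ℚ.≤-trans (left-mono (ℕ.<⇒≤ n<j)) (p≤p+q (ℚ.<⇒≤ (unit>0 (q n ℕ.* d (suc n))))))

  n<q*d : ∀ n → n ℕ.< q n ℕ.* d (suc n)
  n<q*d n = ℕ.<-≤-trans (n<q n) (ℕ.m≤m*n (q n) (d (suc n)) {{d-nonZero (suc n)}})

  limit : ℝ
  seq limit = left
  -- Beyond `N` all terms lie in one interval of length 1/(q d⁺) starting at `left N`, and there q
  -- d⁺ is at least N + 1.
  cauchy limit ε 0<ε = let (N , 1/N<ε) = ∃unit< 0<ε in suc N , λ m n N<m N<n →
    ℚ.≤-<-trans (close N<m N<n) (ℚ.≤-<-trans (unit-anti-≤ (n<q*d N)) 1/N<ε)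
    where
    close : ∀ {N m n} → N ℕ.< m → N ℕ.< n → ℚ.∣ left m ℚ.- left n ∣ ℚ.≤ unit (q N ℕ.* d (suc N))
    close {N} {m} {n} N<m N<n = ∣x-y∣≤ {left m} {left n} (bound N<m N<n) (bound N<n N<m)
      where
      bound : ∀ {m n} → N ℕ.< m → N ℕ.< n → left m ℚ.≤ left n ℚ.+ unit (q N ℕ.* d (suc N))
      bound N<m N<n = ℚ.≤-trans (left-upper N<m) (ℚ.+-monoˡ-≤ (unit (q N ℕ.* d (suc N))) (left-mono (ℕ.<⇒≤ N<n)))

  -- Distance from arbitrary fractions to the limit

  scale : ∀ Q .{{_ : NonZero Q}} → ∃[ n ] Q ℕ.* 2 ℕ.≤ d (suc n) × q n ℕ.≤ Q ℕ.* 4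
  -- The index 2Q qualifies, since 2Q < q ≤ d⁺ there; the search descends from it until the
  -- preceding index fails.
  scale Q = search (Q ℕ.* 2) (ℕ.≤-trans (ℕ.<⇒≤ (n<q (Q ℕ.* 2))) (q≤d (Q ℕ.* 2)))
    where
    Q2+Q2≡Q4 : ∀ Q → Q ℕ.* 2 ℕ.+ Q ℕ.* 2 ≡ Q ℕ.* 4
    Q2+Q2≡Q4 = ℕ-Ring.solve-∀

    search : ∀ n → Q ℕ.* 2 ℕ.≤ d (suc n) → ∃[ n ] Q ℕ.* 2 ℕ.≤ d (suc n) × q n ℕ.≤ Q ℕ.* 4
    search zero h = zero , h , ℕ.≤-trans (ℕ.>-nonZero⁻¹ Q) (ℕ.m≤m*n Q 4)
    search (suc n) h with Q ℕ.* 2 ℕ.≤? d (suc n)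
    ... | yes h′ = search n h′
    -- Failure of the preceding index means d < 2Q at the present one, hence q ≤ 2d ≤ 4Q.
    ... | no ¬h′ = let d≤2Q = ℕ.<⇒≤ (ℕ.≰⇒> ¬h′) in
      suc n , h , ℕ.≤-trans (q≤2d (suc n)) (subst (d (suc n) ℕ.+ d (suc n) ℕ.≤_) (Q2+Q2≡Q4 Q) (ℕ.+-mono-≤ d≤2Q d≤2Q))

  -- Left endpoints are in lowest terms: multiplying eq - pd = 1 by Q and replacing pQ by Pq writes
  -- Q as a difference of two multiples of q.
  q∣ : ∀ n P Q → P ℕ.* q n ≡ p n ℕ.* Q → q n ℕ.∣ Q
  q∣ n P Q eq = ℕ.∣m+n∣m⇒∣n (subst (q n ℕ.∣_) identity (ℕ.n∣m*n (e n ℕ.* Q))) (ℕ.n∣m*n (d n ℕ.* P))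
    where
    open ≡-Reasoning
    assoc₁ : ∀ e Q q → e ℕ.* Q ℕ.* q ≡ e ℕ.* q ℕ.* Q
    assoc₁ = ℕ-Ring.solve-∀
    assoc₂ : ∀ d p Q → suc (p ℕ.* d) ℕ.* Q ≡ d ℕ.* (p ℕ.* Q) ℕ.+ Q
    assoc₂ = ℕ-Ring.solve-∀
    identity : e n ℕ.* Q ℕ.* q n ≡ d n ℕ.* P ℕ.* q n ℕ.+ Q
    identity = begin
      e n ℕ.* Q ℕ.* q n             ≡⟨ assoc₁ (e n) Q (q n) ⟩
      e n ℕ.* q n ℕ.* Q             ≡⟨ cong (ℕ._* Q) (det n) ⟩
      suc (p n ℕ.* d n) ℕ.* Q       ≡⟨ assoc₂ (d n) (p n) Q ⟩
      d n ℕ.* (p n ℕ.* Q) ℕ.+ Q     ≡⟨ cong (λ x → d n ℕ.* x ℕ.+ Q) (sym eq) ⟩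
      d n ℕ.* (P ℕ.* q n) ℕ.+ Q     ≡⟨ cong (ℕ._+ Q) (sym (ℕ.*-assoc (d n) P (q n))) ⟩
      d n ℕ.* P ℕ.* q n ℕ.+ Q       ∎

  module _ (P : ℤ) (Q : ℕ) .{{_ : NonZero Q}} where

    -- The product `Q * 4 * Q * 2` is 8Q² in the shape that `q n * Q * 2` takes under the bound q ≤
    -- 4Q.
    ConvergentOrFar : ℕ → Set
    ConvergentOrFar n = q n ℕ.≤ Q × P ℚ./ Q ≡ left n ⊎
      (∀ {j} → n ℕ.< j → unit (Q ℕ.* 4 ℕ.* Q ℕ.* 2) ℚ.≤ ℚ.∣ left j ℚ.- P ℚ./ Q ∣)

    convergent-or-far : ∃[ n ] ConvergentOrFar n
    convergent-or-far = let (n , 2Q≤d , q≤4Q) = scale Q in n , by-comparison n 2Q≤d q≤4Q (ℤ.<-cmp _ _)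
      where
      by-comparison : ∀ n → Q ℕ.* 2 ℕ.≤ d (suc n) → q n ℕ.≤ Q ℕ.* 4 →
        Tri (P ℤ.* + q n ℤ.< + p n ℤ.* + Q) (P ℤ.* + q n ≡ + p n ℤ.* + Q) (P ℤ.* + q n ℤ.> + p n ℤ.* + Q) →
        ConvergentOrFar n
      by-comparison n _ _ (tri≈ _ eq _) = inj₁ (ℕ.∣⇒≤ (q∣ n ℤ.∣ P ∣ Q (begin
          ℤ.∣ P ∣ ℕ.* q n        ≡⟨ sym (ℤ.abs-* P (+ q n)) ⟩
          ℤ.∣ P ℤ.* + q n ∣      ≡⟨ cong ℤ.∣_∣ eq ⟩
          ℤ.∣ + p n ℤ.* + Q ∣    ≡⟨ ℤ.abs-* (+ p n) (+ Q) ⟩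
          p n ℕ.* Q              ∎)) , /-cross P Q (+ p n) (q n) {{_}} {{q-nonZero n}} eq)
        where open ≡-Reasoning
      -- A fraction to the left of `left n` is at least 1/(qQ) away from it, and later left
      -- endpoints only move further off.
      by-comparison n _ q≤4Q (tri< P/Q<left _ _) = inj₂ λ {j} n<j → ≤∣x-y∣ {left j} {P ℚ./ Q} (inj₁ (begin
          P ℚ./ Q ℚ.+ unit (Q ℕ.* 4 ℕ.* Q ℕ.* 2)   ≤⟨ ℚ.+-monoʳ-≤ (P ℚ./ Q) (unit-anti-≤ Qq≤8Q²) ⟩
          P ℚ./ Q ℚ.+ unit (Q ℕ.* q n)             ≤⟨ /-gap-≤ P Q (+ p n) (q n) {{_}} {{q-nonZero n}} (i<j⇒i+1≤j P/Q<left) ⟩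
          left n                                   ≤⟨ left-mono (ℕ.<⇒≤ n<j) ⟩
          left j                                   ∎))
        where
        open ℚ.≤-Reasoning
        Qq≤8Q² : Q ℕ.* q n ℕ.≤ Q ℕ.* 4 ℕ.* Q ℕ.* 2
        Qq≤8Q² = ℕ.≤-trans (subst (ℕ._≤ Q ℕ.* 4 ℕ.* Q) (ℕ.*-comm (q n) Q) (ℕ.*-monoˡ-≤ Q q≤4Q)) (ℕ.m≤m*n (Q ℕ.* 4 ℕ.* Q) 2)
      -- A fraction to the right is at least 1/(qQ) away from `left n`. Later left endpoints use up
      -- at most 1/(q d⁺) ≤ 1/(2qQ) of this gap, so half of it remains.
      by-comparison n 2Q≤d q≤4Q (tri> _ _ left<P/Q) = inj₂ λ {j} n<j → ≤∣x-y∣ {left j} {P ℚ./ Q} (inj₂ (begin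
          left j ℚ.+ unit (Q ℕ.* 4 ℕ.* Q ℕ.* 2)                            ≤⟨ ℚ.+-mono-≤ (left-upper n<j)
                                                                                (unit-anti-≤ (ℕ.*-monoˡ-≤ 2 (ℕ.*-monoˡ-≤ Q q≤4Q))) ⟩
          left n ℚ.+ unit (q n ℕ.* d (suc n)) ℚ.+ unit (q n ℕ.* Q ℕ.* 2)   ≤⟨ ℚ.+-monoˡ-≤ (unit (q n ℕ.* Q ℕ.* 2))
                                                                                (ℚ.+-monoʳ-≤ (left n) (unit-anti-≤ qQ2≤qd)) ⟩
          left n ℚ.+ unit (q n ℕ.* Q ℕ.* 2) ℚ.+ unit (q n ℕ.* Q ℕ.* 2)     ≡⟨ ℚ.+-assoc (left n) _ _ ⟩
          left n ℚ.+ (unit (q n ℕ.* Q ℕ.* 2) ℚ.+ unit (q n ℕ.* Q ℕ.* 2))   ≡⟨ cong (left n ℚ.+_) (unit-double (q n ℕ.* Q) {{ℕ.m*n≢0 (q n) Q {{q-nonZero n}}}}) ⟩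
          left n ℚ.+ unit (q n ℕ.* Q)                                      ≤⟨ /-gap-≤ (+ p n) (q n) P Q {{q-nonZero n}} (i<j⇒i+1≤j left<P/Q) ⟩
          P ℚ./ Q                                                          ∎))
        where
        open ℚ.≤-Reasoning
        qQ2≤qd : q n ℕ.* Q ℕ.* 2 ℕ.≤ q n ℕ.* d (suc n)
        qQ2≤qd = subst (ℕ._≤ q n ℕ.* d (suc n)) (sym (ℕ.*-assoc (q n) Q 2)) (ℕ.*-monoʳ-≤ (q n) 2Q≤d)

-- Real numbers

infix 4 _≲_

-- A termwise order on representatives. Unlike `_≤_`, which is a negation, it carries positive
-- information and composes directly with `_<_`.
_≲_ : ℝ → ℝ → Set
x ≲ y = ∃[ N ] (∀ {n} → N ℕ.≤ n → seq x n ℚ.≤ seq y n)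

fromℚ-mono-< : ∀ {r s} → r ℚ.< s → fromℚ r < fromℚ s
fromℚ-mono-< {r} {s} r<s = s ℚ.- r , subst (ℚ._< s ℚ.- r) (ℚ.+-inverseʳ r) (ℚ.+-monoˡ-< (ℚ.- r) r<s) ,
  0 , λ _ _ → ℚ.≤-reflexive (solve 2 (λ r s → r :+ (s :- r) := s) refl r s)

<⇒≲ : ∀ {x y} → x < y → x ≲ y
<⇒≲ {x} (ε , 0<ε , N , h) = N , λ {n} N≤n → ℚ.≤-trans (p≤p+q (ℚ.<⇒≤ 0<ε)) (h n N≤n)

<-≲-trans : ∀ {x y z} → x < y → y ≲ z → x < z
<-≲-trans (ε , 0<ε , N , h) (M , k) = ε , 0<ε , N ℕ.⊔ M , λ n N⊔M≤n →
  ℚ.≤-trans (h n (ℕ.m⊔n≤o⇒m≤o N M N⊔M≤n)) (k (ℕ.m⊔n≤o⇒n≤o N M N⊔M≤n))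

≲-<-trans : ∀ {x y z} → x ≲ y → y < z → x < z
≲-<-trans (M , k) (ε , 0<ε , N , h) = ε , 0<ε , N ℕ.⊔ M , λ n N⊔M≤n →
  ℚ.≤-trans (ℚ.+-monoˡ-≤ ε (k (ℕ.m⊔n≤o⇒n≤o N M N⊔M≤n))) (h n (ℕ.m⊔n≤o⇒m≤o N M N⊔M≤n))

<-trans : ∀ {x y z} → x < y → y < z → x < z
<-trans {x} {y} {z} x<y y<z = ≲-<-trans {x} {y} {z} (<⇒≲ {x} {y} x<y) y<z

<-irrefl : ∀ {x} → ¬ (x < x)
<-irrefl {x} (ε , 0<ε , N , h) = ℚ.<-irrefl refl (ℚ.<-≤-trans
  (subst (ℚ._< seq x N ℚ.+ ε) (ℚ.+-identityʳ (seq x N)) (ℚ.+-monoʳ-< (seq x N) 0<ε)) (h N ℕ.≤-refl))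

half-pos : ∀ {ε} → 0ℚ ℚ.< ε → 0ℚ ℚ.< ½ ℚ.* ε
half-pos {ε} 0<ε = subst (ℚ._< ½ ℚ.* ε) (ℚ.*-zeroʳ ½) (ℚ.*-monoʳ-<-pos ½ 0<ε)

∣x-y∣<⇒x≤y+ : ∀ {x y w} → ℚ.∣ x ℚ.- y ∣ ℚ.< w → x ℚ.≤ y ℚ.+ w
∣x-y∣<⇒x≤y+ {x} {y} {w} h = subst (ℚ._≤ y ℚ.+ w) (solve 2 (λ x y → y :+ (x :- y) := x) refl x y)
  (ℚ.+-monoʳ-≤ y (ℚ.≤-trans (x≤∣x∣ (x ℚ.- y)) (ℚ.<⇒≤ h)))

<-respʳ-≃ : ∀ {x y z} → y ≃ z → x < y → x < z
<-respʳ-≃ {x} {y} {z} y≃z (ε , 0<ε , N , h) with M , k ← y≃z (½ ℚ.* ε) (half-pos 0<ε) =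
  ½ ℚ.* ε , half-pos 0<ε , N ℕ.⊔ M , λ n N⊔M≤n → begin
    seq x n ℚ.+ ½ ℚ.* ε
      ≡⟨ solve 2 (λ x ε → x :+ con ½ :* ε := x :+ ε :- con ½ :* ε) refl (seq x n) ε ⟩
    seq x n ℚ.+ ε ℚ.- ½ ℚ.* ε
      ≤⟨ ℚ.+-monoˡ-≤ (ℚ.- (½ ℚ.* ε)) (h n (ℕ.m⊔n≤o⇒m≤o N M N⊔M≤n)) ⟩
    seq y n ℚ.- ½ ℚ.* ε
      ≤⟨ ℚ.+-monoˡ-≤ (ℚ.- (½ ℚ.* ε)) (∣x-y∣<⇒x≤y+ {seq y n} {seq z n} (k n (ℕ.m⊔n≤o⇒n≤o N M N⊔M≤n))) ⟩
    seq z n ℚ.+ ½ ℚ.* ε ℚ.- ½ ℚ.* ε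
      ≡⟨ solve 2 (λ z ε → z :+ ε :- ε := z) refl (seq z n) (½ ℚ.* ε) ⟩
    seq z n ∎
  where open ℚ.≤-Reasoning

≃⇒∣-∣≯0 : ∀ {x y} → x ≃ y → ¬ (0ℝ < ∣ x - y ∣)
≃⇒∣-∣≯0 {x} {y} x≃y (ε , 0<ε , N , h) = let (M , k) = x≃y ε 0<ε in
  ℚ.<-irrefl refl (ℚ.≤-<-trans
    (subst (ℚ._≤ ℚ.∣ seq x (N ℕ.⊔ M) ℚ.- seq y (N ℕ.⊔ M) ∣) (ℚ.+-identityˡ ε) (h (N ℕ.⊔ M) (ℕ.m≤m⊔n N M)))
    (k (N ℕ.⊔ M) (ℕ.m≤n⊔m N M)))

pointwise⇒≃ : ∀ {x y} → (∀ n → seq x n ≡ seq y n) → x ≃ y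
pointwise⇒≃ {x} {y} eq ε 0<ε = 0 , λ n _ → subst (λ r → ℚ.∣ r ℚ.- seq y n ∣ ℚ.< ε) (sym (eq n))
  (subst (ℚ._< ε) (cong ℚ.∣_∣ (sym (ℚ.+-inverseʳ (seq y n)))) 0<ε)

-- A constructive substitute for trichotomy. A late term of `y` is compared with the midpoint of r
-- and s; one quarter `δ` of the distance absorbs the oscillation of `y`, and another is the gap
-- that `_<_` demands.
fromℚ-cotrans : ∀ {r s} (y : ℝ) → r ℚ.< s → fromℚ r < y ⊎ y < fromℚ s
fromℚ-cotrans {r} {s} y r<s = go (cauchy y δ 0<δ) (ℚ.≤-total (seq y (proj₁ (cauchy y δ 0<δ))) (r ℚ.+ δ ℚ.+ δ))
  where
  open ℚ.≤-Reasoning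
  δ = ½ ℚ.* (½ ℚ.* (s ℚ.- r))
  0<δ : 0ℚ ℚ.< δ
  0<δ = half-pos (half-pos (proj₁ (proj₂ (fromℚ-mono-< r<s))))

  go : ((N , _) : ∃[ N ] (∀ m n → N ℕ.≤ m → N ℕ.≤ n → ℚ.∣ seq y m ℚ.- seq y n ∣ ℚ.< δ)) →
       seq y N ℚ.≤ r ℚ.+ δ ℚ.+ δ ⊎ r ℚ.+ δ ℚ.+ δ ℚ.≤ seq y N → fromℚ r < y ⊎ y < fromℚ s
  go (N , h) (inj₁ yN≤) = inj₂ (δ , 0<δ , N , λ n N≤n → begin
    seq y n ℚ.+ δ                  ≤⟨ ℚ.+-monoˡ-≤ δ (∣x-y∣<⇒x≤y+ {seq y n} {seq y N} (h n N N≤n ℕ.≤-refl)) ⟩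
    seq y N ℚ.+ δ ℚ.+ δ            ≤⟨ ℚ.+-monoˡ-≤ δ (ℚ.+-monoˡ-≤ δ yN≤) ⟩
    r ℚ.+ δ ℚ.+ δ ℚ.+ δ ℚ.+ δ      ≡⟨ solve 2 (λ r s → let δ = con ½ :* (con ½ :* (s :- r)) in
                                         r :+ δ :+ δ :+ δ :+ δ := s) refl r s ⟩
    s                              ∎)
  go (N , h) (inj₂ ≤yN) = inj₁ (δ , 0<δ , N , λ n N≤n → begin
    r ℚ.+ δ                        ≡⟨ solve 2 (λ r δ → r :+ δ := r :+ δ :+ δ :- δ) refl r δ ⟩
    r ℚ.+ δ ℚ.+ δ ℚ.- δ            ≤⟨ ℚ.+-monoˡ-≤ (ℚ.- δ) ≤yN ⟩
    seq y N ℚ.- δ                  ≤⟨ ℚ.+-monoˡ-≤ (ℚ.- δ) (∣x-y∣<⇒x≤y+ {seq y N} {seq y n} (h N n ℕ.≤-refl N≤n)) ⟩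
    seq y n ℚ.+ δ ℚ.- δ            ≡⟨ solve 2 (λ y δ → y :+ δ :- δ := y) refl (seq y n) δ ⟩
    seq y n                        ∎)

fromℕ-cancel-< : ∀ {m n} → fromℕ m < fromℕ n → m ℕ.< n
fromℕ-cancel-< {m} {n} h = ℕ.≰⇒> λ n≤m → <-irrefl {fromℕ m}
  (<-≲-trans {fromℕ m} {fromℕ n} {fromℕ m} h (0 , λ _ → /-monoℕ-≤ n 1 m 1 (ℕ.*-monoˡ-≤ 1 n≤m)))

fromℕ-mono-< : ∀ {m n} → m ℕ.< n → fromℕ m < fromℕ n
fromℕ-mono-< {m} {n} m<n = fromℚ-mono-< (/-mono-< (+ m) 1 (+ n) 1 (ℤ.*-monoʳ-<-pos 1ℤ (ℤ.+<+ m<n)))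

archimedean : ∀ x → ∃[ n ] x < fromℕ n
archimedean x =
  let (N , h) = cauchy x 1ℚ (ℚ.positive⁻¹ 1ℚ)
      -- One of the two added units bounds the oscillation after `N`, the other is the gap in `_<_`.
      (K , le) = bound (seq x N ℚ.+ 1ℚ ℚ.+ 1ℚ)
  in K , 1ℚ , ℚ.positive⁻¹ 1ℚ , N , λ n N≤n →
    ℚ.≤-trans (ℚ.+-monoˡ-≤ 1ℚ (∣x-y∣<⇒x≤y+ {seq x n} {seq x N} (h n N N≤n ℕ.≤-refl))) le
  where
  ≤∣∣ : ∀ i → i ℤ.≤ + ℤ.∣ i ∣
  ≤∣∣ (+ n)    = ℤ.≤-refl
  ≤∣∣ -[1+ n ] = ℤ.-≤+

  bound : ∀ r → ∃[ n ] r ℚ.≤ + n ℚ./ 1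
  bound r@(ℚ.mkℚ i d _) = ℤ.∣ i ∣ , subst (ℚ._≤ + ℤ.∣ i ∣ ℚ./ 1) (ℚ.↥p/↧p≡p r)
    (/-mono-≤ i (suc d) (+ ℤ.∣ i ∣) 1 (ℤ.≤-trans (ℤ.≤-reflexive (ℤ.*-identityʳ i)) (ℤ.≤-trans (≤∣∣ i)
      (subst (+ ℤ.∣ i ∣ ℤ.≤_) (ℤ.pos-* ℤ.∣ i ∣ (suc d)) (ℤ.+≤+ (ℕ.m≤m*n ℤ.∣ i ∣ (suc d)))))))

unit-small : ∀ {x} → 0ℝ < x → ∃[ n ] fromℚ (unit (suc n)) < x
unit-small {x} (ε , 0<ε , N , h) = let (n , 1/n<ε) = ∃unit< 0<ε in n ,
  <-≲-trans {fromℚ (unit (suc n))} {fromℚ ε} {x} (fromℚ-mono-< 1/n<ε)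
    (N , λ {m} N≤m → subst (ℚ._≤ seq x m) (ℚ.+-identityˡ ε) (h m N≤m))

-- Since t (m − 1) and x cannot be compared exactly, x is located only between t m and t (m − 2).
descend : ∀ (t : ℕ → ℚ) → (∀ k → t (suc k) ℚ.< t k) → ∀ (x : ℝ) M → fromℚ (t M) < x →
          ∃[ m ] fromℚ (t m) < x × (∀ {k} → m ≡ suc (suc k) → x < fromℚ (t k))
descend t t-anti x zero h = 0 , h , λ ()
descend t t-anti x (suc zero) h = 1 , h , λ ()
descend t t-anti x (suc (suc m)) h =
  [ descend t t-anti x (suc m) , (λ x<tm → suc (suc m) , h , λ { refl → x<tm }) ]′ (fromℚ-cotrans x (t-anti m))

unit-homo-* : ∀ m n .{{_ : NonZero m}} .{{_ : NonZero n}} → unit m ℚ.* unit n ≡ unit (m ℕ.* n)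
unit-homo-* m@(suc _) n@(suc _) = /-homo-* 1ℤ m 1ℤ n

fromℕ-unit : ∀ q .{{_ : NonZero q}} → (+ q ℚ./ 1) ℚ.* unit q ≡ 1ℚ
fromℕ-unit q@(suc _) = trans (/-homo-* (+ q) 1 1ℤ q) (/-cross (+ q ℤ.* 1ℤ) (1 ℕ.* q) 1ℤ 1 (cong +_ (identity q)))
  where
  identity : ∀ q → q ℕ.* 1 ℕ.* 1 ≡ 1 ℕ.* (1 ℕ.* q)
  identity = ℕ-Ring.solve-∀

-- The maximum with 1 in the definition of `_⁻¹` is inactive at an integer q ≥ 1.
seq-fromℕ⁻¹ : ∀ q .{{_ : NonZero q}} n → seq (fromℕ≥1 q ⁻¹) n ≡ unit q
seq-fromℕ⁻¹ q n = begin
  i                          ≡⟨ sym (ℚ.*-identityʳ i) ⟩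
  i ℚ.* 1ℚ                   ≡⟨ cong (i ℚ.*_) (sym (fromℕ-unit q)) ⟩
  i ℚ.* (r ℚ.* unit q)       ≡⟨ sym (ℚ.*-assoc i r (unit q)) ⟩
  i ℚ.* r ℚ.* unit q         ≡⟨ cong (λ s → i ℚ.* s ℚ.* unit q) (sym (ℚ.p≤q⇒p⊔q≡q 1≤r)) ⟩
  i ℚ.* (1ℚ ℚ.⊔ r) ℚ.* unit q  ≡⟨ cong (ℚ._* unit q) (ℚ.*-inverseˡ (1ℚ ℚ.⊔ r) {{nz}}) ⟩
  1ℚ ℚ.* unit q              ≡⟨ ℚ.*-identityˡ (unit q) ⟩
  unit q                     ∎
  where
  open ≡-Reasoning
  i = seq (fromℕ≥1 q ⁻¹) n
  r = + q ℚ./ 1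
  1≤r : 1ℚ ℚ.≤ r
  1≤r = /-monoℕ-≤ 1 1 q 1 (ℕ.*-monoˡ-≤ 1 (ℕ.>-nonZero⁻¹ q))
  nz : ℚ.NonZero (1ℚ ℚ.⊔ r)
  nz = ℚ.pos⇒nonZero (1ℚ ℚ.⊔ r) {{ℚ.positive (ℚ.<-≤-trans (ℚ.positive⁻¹ 1ℚ) (ℚ.p≤p⊔q 1ℚ r))}}

-- Admissible exponents

module _ (f : IrrationalityMeasure) where
  open IrrationalityMeasure f

  -- Since `decreasing-x` is strict, m = n is a separate case; the common upper bound `y` gives both
  -- cases the same strict conclusion.
  value-anti-≤ : ∀ {m n ν y} .{{_ : NonZero m}} .{{_ : NonZero n}} → m ℕ.≤ n →
                 proj₁ (value (fromℕ≥1 m) ν) < y → proj₁ (value (fromℕ≥1 n) ν) < y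
  value-anti-≤ {m} {n} {ν} {y} m≤n h = [ strict , (λ { refl → h }) ]′ (ℕ.m≤n⇒m<n∨m≡n m≤n)
    where
    strict : m ℕ.< n → proj₁ (value (fromℕ≥1 n) ν) < y
    strict m<n = <-trans {proj₁ (value (fromℕ≥1 n) ν)} {proj₁ (value (fromℕ≥1 m) ν)} {y}
      (decreasing-x ν (fromℕ-mono-< m<n)) h

  value-+ : ∀ x μ ε → proj₁ (value x (μ +⁺ ε)) < proj₁ (value x μ)
  value-+ x μ (ε , e , 0<e , N , h) = decreasing-λ x (e , 0<e , N , λ n N≤n →
    ℚ.+-monoʳ-≤ (seq (proj₁ μ) n) (subst (ℚ._≤ seq ε n) (ℚ.+-identityˡ e) (h n N≤n)))

  -- A rational α = p/q is also pQ/(qQ), a fraction of large denominator at distance 0, whereas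
  -- admissibility (with ε = μ) puts a positive value below that distance.
  admissible⇒irrational : ∀ {α μ} → Admissible f α μ → Irrational α
  admissible⇒irrational {α} {μ} admissible p q α≃p/q =
    let (Q , Q≢0 , far) = admissible μ
        instance
          _ = Q≢0
        qQ≢0 = ℕ.m*n≢0 q Q
        v = value (fromℕ≥1 (q ℕ.* Q) {{qQ≢0}}) (μ +⁺ μ)
        r = (p ℤ.* + Q ℚ./ (q ℕ.* Q)) {{qQ≢0}}
    in ≃⇒∣-∣≯0 {α} {fromℚ r} (subst (λ r → α ≃ fromℚ r) (expand Q {{Q≢0}} {{qQ≢0}}) α≃p/q)
      (<-trans {0ℝ} {proj₁ v} {∣ α - fromℚ r ∣} (proj₂ v) (far (p ℤ.* + Q) (q ℕ.* Q) {{qQ≢0}} (ℕ.m≤n*m Q q)))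
    where
    identity : ∀ p q Q → p ℤ.* (q ℤ.* Q) ≡ p ℤ.* Q ℤ.* q
    identity = ℤ-Ring.solve-∀

    expand : ∀ Q .{{_ : NonZero Q}} .{{_ : NonZero (q ℕ.* Q)}} → p ℚ./ q ≡ (p ℤ.* + Q) ℚ./ (q ℕ.* Q)
    expand Q = /-cross p q (p ℤ.* + Q) (q ℕ.* Q)
      (trans (cong (p ℤ.*_) (ℤ.pos-* q Q)) (identity p (+ q) (+ Q)))

  -- If ν < μ, admissibility of ν with ε = μ - ν bounds distances below by f(q, μ) for all large q,
  -- against approximability. As ν + (μ - ν) is only `_≃_`-equal to μ, `value-cong` is used.
  approximable⇒minimal : ∀ {α μ} → ApproximableToOrder α (at μ) → ∀ ν → Admissible f α ν → proj₁ μ ≤ proj₁ ν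
  approximable⇒minimal {α} {μ} approximable ν admissible (ε , 0<ε , N , h) =
    let (Q , Q≢0 , far) = admissible δ
        (p , q , q≢0 , Q<q , near) = approximable (fromℕ Q , fromℕ-mono-< {0} (ℕ.>-nonZero⁻¹ Q {{Q≢0}}))
        x = fromℕ≥1 q {{q≢0}}
        D = ∣ α - fromℚ ((p ℚ./ q) {{q≢0}}) ∣
    in <-irrefl {D} (<-trans {D} {proj₁ (value x (ν +⁺ δ))} {D}
      (<-respʳ-≃ {D} {proj₁ (value x μ)} {proj₁ (value x (ν +⁺ δ))}
        (value-cong {x} {x} {μ} {ν +⁺ δ} (pointwise⇒≃ {proj₁ x} {proj₁ x} (λ _ → refl))
          (pointwise⇒≃ {proj₁ μ} {proj₁ (ν +⁺ δ)} λ n →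
            solve 2 (λ m n → m := n :+ (m :- n)) refl (seq (proj₁ μ) n) (seq (proj₁ ν) n))) near)
      (far p q {{q≢0}} (ℕ.<⇒≤ (fromℕ-cancel-< Q<q))))
    where
    δ : ℝ⁺
    δ = proj₁ μ - proj₁ ν , ε , 0<ε , N , λ n N≤n → subst (ℚ._≤ seq (proj₁ μ) n ℚ.- seq (proj₁ ν) n)
      (sym (ℚ.+-identityˡ ε)) (a+w≤x⇒w≤x-a {seq (proj₁ μ) n} {seq (proj₁ ν) n} (h n N≤n))

  -- Discrete forms of the two hypotheses

  module _ (μ : ℝ⁺) where

    -- Expresses q² f(q,μ) → 0 through unit fractions.
    Vanishing : Set
    Vanishing = ∀ k → ∃[ N ] (∀ q .{{_ : NonZero q}} → N ℕ.≤ q →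
      proj₁ (value (fromℕ≥1 q) μ) < fromℚ (unit (q ℕ.* q ℕ.* suc k)))

    -- The constant c is replaced by a fraction k/(k + 1) ≥ c; the condition on A and B says that
    -- k/(k + 1) times 1/B is at most 1/A.
    Contracting : Set
    Contracting = ∀ ε → ∃[ k ] ∃[ N ] (∀ q .{{_ : NonZero q}} → N ℕ.≤ q →
      ∀ A B .{{_ : NonZero A}} .{{_ : NonZero B}} → k ℕ.* A ℕ.≤ suc k ℕ.* B →
      proj₁ (value (fromℕ≥1 q) μ) < fromℚ (unit B) → proj₁ (value (fromℕ≥1 q) (μ +⁺ ε)) < fromℚ (unit A))

    eventually-ℕ : ∀ {P} → Eventually P → ∃[ N ] (∀ q .{{_ : NonZero q}} → N ℕ.≤ q → P (fromℕ≥1 q))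
    eventually-ℕ (X , h) = let (N , X<N) = archimedean X in N , λ q N≤q → h (fromℕ≥1 q) λ q<X →
      ℕ.<-irrefl refl (ℕ.<-≤-trans (fromℕ-cancel-< {q} {N} (<-trans {fromℕ q} {X} {fromℕ N} q<X X<N)) N≤q)

    littleO⇒vanishing : LittleO (λ x → proj₁ (value x μ)) (λ x → x ⁻¹ * x ⁻¹) → Vanishing
    littleO⇒vanishing small k = let (N , h) = eventually-ℕ (small η) in N , λ q N≤q → by-cotrans q (h q N≤q)
      where
      η : ℝ⁺
      -- Half of the target 1/(k + 1): `LittleO` yields a negated inequality, which becomes a strict
      -- one only against a larger rational.
      η = fromℚ (unit (suc k ℕ.* 2)) , fromℚ-mono-< (unit>0 (suc k ℕ.* 2))

      by-cotrans : ∀ q .{{_ : NonZero q}} → let y = proj₁ (value (fromℕ≥1 q) μ); i = fromℕ≥1 q ⁻¹ in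
        ∣ y ∣ ≤ proj₁ η * ∣ i * i ∣ → y < fromℚ (unit (q ℕ.* q ℕ.* suc k))
      by-cotrans q ∣y∣≤ = [ (λ K2<y → contradiction (too-large K2<y) ∣y∣≤) , (λ h → h) ]′
        (fromℚ-cotrans y (subst (unit (K ℕ.* 2) ℚ.<_) (unit-double K)
          (subst (ℚ._< unit (K ℕ.* 2) ℚ.+ unit (K ℕ.* 2)) (ℚ.+-identityʳ (unit (K ℕ.* 2)))
            (ℚ.+-monoʳ-< (unit (K ℕ.* 2)) (unit>0 (K ℕ.* 2))))))
        where
        y = proj₁ (value (fromℕ≥1 q) μ)
        i = fromℕ≥1 q ⁻¹
        K = q ℕ.* q ℕ.* suc k
        instance
          qq≢0 : NonZero (q ℕ.* q)
          qq≢0 = ℕ.m*n≢0 q q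
          K≢0 : NonZero K
          K≢0 = ℕ.m*n≢0 (q ℕ.* q) (suc k)

        assoc : ∀ q k → suc k ℕ.* 2 ℕ.* (q ℕ.* q) ≡ q ℕ.* q ℕ.* suc k ℕ.* 2
        assoc = ℕ-Ring.solve-∀

        η/q² : ∀ n → unit (suc k ℕ.* 2) ℚ.* ℚ.∣ seq i n ℚ.* seq i n ∣ ≡ unit (K ℕ.* 2)
        η/q² n = begin
          unit (suc k ℕ.* 2) ℚ.* ℚ.∣ seq i n ℚ.* seq i n ∣
            ≡⟨ cong (λ u → unit (suc k ℕ.* 2) ℚ.* ℚ.∣ u ℚ.* u ∣) (seq-fromℕ⁻¹ q n) ⟩
          unit (suc k ℕ.* 2) ℚ.* ℚ.∣ unit q ℚ.* unit q ∣
            ≡⟨ cong (λ u → unit (suc k ℕ.* 2) ℚ.* ℚ.∣ u ∣) (unit-homo-* q q) ⟩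
          unit (suc k ℕ.* 2) ℚ.* ℚ.∣ unit (q ℕ.* q) ∣
            ≡⟨ cong (unit (suc k ℕ.* 2) ℚ.*_) (ℚ.0≤p⇒∣p∣≡p (ℚ.<⇒≤ (unit>0 (q ℕ.* q)))) ⟩
          unit (suc k ℕ.* 2) ℚ.* unit (q ℕ.* q)
            ≡⟨ unit-homo-* (suc k ℕ.* 2) (q ℕ.* q) ⟩
          unit (suc k ℕ.* 2 ℕ.* (q ℕ.* q))
            ≡⟨ cong unit (assoc q k) ⟩
          unit (K ℕ.* 2) ∎
          where open ≡-Reasoning

        too-large : fromℚ (unit (K ℕ.* 2)) < y → proj₁ η * ∣ i * i ∣ < ∣ y ∣
        too-large K2<y = ≲-<-trans {proj₁ η * ∣ i * i ∣} {fromℚ (unit (K ℕ.* 2))} {∣ y ∣}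
          (0 , λ {n} _ → ℚ.≤-reflexive (η/q² n))
          (<-≲-trans {fromℚ (unit (K ℕ.* 2))} {y} {∣ y ∣} K2<y (0 , λ {n} _ → x≤∣x∣ (seq y n)))

    contraction⇒contracting : (∀ (ε : ℝ⁺) → Σ[ c ∈ ℝ⁺ ] proj₁ c < 1ℝ ×
      Eventually (λ x → proj₁ (value x (μ +⁺ ε)) < proj₁ c * proj₁ (value x μ))) → Contracting
    contraction⇒contracting contraction ε =
      let ((c , _) , c<1 , eventually) = contraction ε
          (k , c≲k/k+1) = <1⇒≲k/k+1 c c<1
          (N , h) = eventually-ℕ eventually
      in k , N , λ q N≤q A B kA≤B y<1/B → <-≲-trans
        {proj₁ (value (fromℕ≥1 q) (μ +⁺ ε))} {c * proj₁ (value (fromℕ≥1 q) μ)} {fromℚ (unit A)}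
        (h q N≤q) (bound k c c≲k/k+1 (value (fromℕ≥1 q) μ) A B kA≤B y<1/B)
      where
      r : ℕ → ℚ
      r k = + k ℚ./ suc k

      1≤r+1/k : ∀ k → 1ℚ ℚ.≤ r k ℚ.+ unit (suc k)
      1≤r+1/k k = subst (λ m → 1ℚ ℚ.≤ r k ℚ.+ unit m) (ℕ.*-identityʳ (suc k))
        (/-gap-≥ (+ k) (suc k) 1ℤ 1 (ℤ.≤-reflexive (trans (ℤ.*-identityˡ (+ suc k))
          (trans (cong +_ (ℕ.+-comm 1 k)) (cong (ℤ._+ 1ℤ) (sym (ℤ.*-identityʳ (+ k))))))))

      <1⇒≲k/k+1 : ∀ c → c < 1ℝ → ∃[ k ] c ≲ fromℚ (r k)
      -- With 1/(k + 1) below the gap `g`, c ≤ 1 - g ≤ k/(k + 1).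
      <1⇒≲k/k+1 c (g , 0<g , M , c+g≤1) = let (k , 1/k<g) = ∃unit< 0<g in k , M , λ {n} M≤n → begin
        seq c n                                    ≤⟨ a+w≤x⇒w≤x-a {1ℚ} {g} (subst (ℚ._≤ 1ℚ) (ℚ.+-comm (seq c n) g) (c+g≤1 n M≤n)) ⟩
        1ℚ ℚ.- g                                   ≤⟨ ℚ.+-mono-≤ (1≤r+1/k k) (ℚ.neg-antimono-≤ (ℚ.<⇒≤ 1/k<g)) ⟩
        r k ℚ.+ unit (suc k) ℚ.- unit (suc k)      ≡⟨ solve 2 (λ r u → r :+ u :- u := r) refl (r k) (unit (suc k)) ⟩
        r k                                        ∎
        where open ℚ.≤-Reasoning

      r/B≤1/A : ∀ k A B .{{_ : NonZero A}} .{{_ : NonZero B}} → k ℕ.* A ℕ.≤ suc k ℕ.* B → r k ℚ.* unit B ℚ.≤ unit A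
      r/B≤1/A k A@(suc _) B@(suc _) h = subst (ℚ._≤ unit A) (sym (/-homo-* (+ k) (suc k) 1ℤ B))
        (subst (λ i → i ℚ./ (suc k ℕ.* B) ℚ.≤ unit A) (sym (ℤ.*-identityʳ (+ k)))
          (/-monoℕ-≤ k (suc k ℕ.* B) 1 A (subst (k ℕ.* A ℕ.≤_) (sym (ℕ.*-identityˡ (suc k ℕ.* B))) h)))

      bound : ∀ k c → c ≲ fromℚ (r k) → ∀ ((y , _) : ℝ⁺) A B .{{_ : NonZero A}} .{{_ : NonZero B}} →
        k ℕ.* A ℕ.≤ suc k ℕ.* B → y < fromℚ (unit B) → c * y ≲ fromℚ (unit A)
      bound k c (M , c≤r) (y , 0<y) A B h y<1/B =
        let (N₁ , 0≤y) = <⇒≲ {0ℝ} {y} 0<y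
            (N₂ , y≤1/B) = <⇒≲ {y} {fromℚ (unit B)} y<1/B
        in M ℕ.⊔ (N₁ ℕ.⊔ N₂) , λ {n} N≤n → begin
          seq c n ℚ.* seq y n    ≤⟨ ℚ.*-monoʳ-≤-nonNeg (seq y n) {{ℚ.nonNegative (0≤y (ℕ.m⊔n≤o⇒m≤o N₁ N₂ (ℕ.m⊔n≤o⇒n≤o M _ N≤n)))}}
                                      (c≤r (ℕ.m⊔n≤o⇒m≤o M _ N≤n)) ⟩
          r k ℚ.* seq y n        ≤⟨ ℚ.*-monoˡ-≤-nonNeg (r k) {{ℚ.normalize-nonNeg k (suc k)}}
                                      (y≤1/B (ℕ.m⊔n≤o⇒n≤o N₁ N₂ (ℕ.m⊔n≤o⇒n≤o M _ N≤n))) ⟩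
          r k ℚ.* unit B         ≤⟨ r/B≤1/A k A B h ⟩
          unit A                 ∎
        where open ℚ.≤-Reasoning

-- The choice of the path

module Construction (f : IrrationalityMeasure) (μ : ℝ⁺)
                    (vanishing : Vanishing f μ) (contracting : Contracting f μ) where
  open IrrationalityMeasure f

  f⟨_⟩ : ∀ q .{{_ : NonZero q}} → ℝ
  f⟨ q ⟩ = proj₁ (value (fromℕ≥1 q) μ)

  -- After m + 1 left turns d⁺ is about (m + 1)q, so m is chosen to make q²(m + 1) close to
  -- 1/f(q,μ). The search descends from an `M` for which already 1/(M + 1) < f(q,μ).
  multiplier : ∀ q .{{_ : NonZero q}} → ∃[ m ] fromℚ (unit (q ℕ.* q ℕ.* suc m)) < f⟨ q ⟩ ×
    (∀ {k} → m ≡ suc (suc k) → f⟨ q ⟩ < fromℚ (unit (q ℕ.* q ℕ.* suc k)))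
  multiplier q = let (M , 1/M<f) = unit-small {f⟨ q ⟩} (proj₂ (value (fromℕ≥1 q) μ)) in
    descend (λ k → unit (q ℕ.* q ℕ.* suc k)) (λ k → unit-anti-< {{ℕ.m*n≢0 (q ℕ.* q) (suc k)}} (anti k)) f⟨ q ⟩ M
      (≲-<-trans {fromℚ (unit (q ℕ.* q ℕ.* suc M))} {fromℚ (unit (suc M))} {f⟨ q ⟩}
        (0 , λ _ → unit-anti-≤ (ℕ.m≤n*m (suc M) (q ℕ.* q))) 1/M<f)
    where
    instance
      qq≢0 : NonZero (q ℕ.* q)
      qq≢0 = ℕ.m*n≢0 q q

    anti : ∀ k → q ℕ.* q ℕ.* suc k ℕ.< q ℕ.* q ℕ.* suc (suc k)
    anti k = ℕ.*-monoʳ-< (q ℕ.* q) (ℕ.n<1+n (suc k))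

  a : ℕ → ℕ
  -- A default value: the denominators `q n` are never 0.
  a zero = 0
  a q@(suc _) = proj₁ (multiplier q)

  a-lower : ∀ q .{{_ : NonZero q}} → fromℚ (unit (q ℕ.* q ℕ.* suc (a q))) < f⟨ q ⟩
  a-lower q@(suc _) = proj₁ (proj₂ (multiplier q))

  a-upper : ∀ q .{{_ : NonZero q}} {k} → a q ≡ suc (suc k) → f⟨ q ⟩ < fromℚ (unit (q ℕ.* q ℕ.* suc k))
  a-upper q@(suc _) = proj₂ (proj₂ (multiplier q))

  -- Follows by comparison with the lower bound `a-lower`. Through `vanishing` it makes `a q` tend
  -- to infinity with q.
  a-large : ∀ q .{{_ : NonZero q}} {k} → f⟨ q ⟩ < fromℚ (unit (q ℕ.* q ℕ.* suc k)) → k ℕ.< a q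
  a-large q {k} h = ℕ.≰⇒> λ a≤k → <-irrefl {f⟨ q ⟩} (<-trans {f⟨ q ⟩} {fromℚ (unit (q ℕ.* q ℕ.* suc k))} {f⟨ q ⟩} h
    (≲-<-trans {fromℚ (unit (q ℕ.* q ℕ.* suc k))} {fromℚ (unit (q ℕ.* q ℕ.* suc (a q)))} {f⟨ q ⟩}
      (0 , λ _ → unit-anti-≤ (ℕ.*-monoʳ-≤ (q ℕ.* q) (ℕ.s≤s a≤k))) (a-lower q)))

  -- Approximability and admissibility of the limit

  open SternBrocot a

  private
    f⟨q_⟩ : ℕ → ℝ
    f⟨q n ⟩ = f⟨ q n ⟩ {{q-nonZero n}}

  -- Since d⁺ ≥ (a + 1)q, the distance to a left endpoint is at most 1/(q d⁺) ≤ 1/(q²(a + 1)) <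
  -- f(q,μ).
  approximable : ApproximableToOrder limit (at μ)
  approximable (C , _) = let (n , C<n) = archimedean C in
    + p n , q n , q-nonZero n ,
    <-trans {C} {fromℕ n} {fromℕ (q n)} C<n (fromℕ-mono-< (n<q n)) ,
    ≲-<-trans {∣ limit - fromℚ (left n) ∣} {fromℚ (unit (q n ℕ.* q n ℕ.* suc (a (q n))))} {f⟨q n ⟩}
      (suc n , λ n<j → ℚ.≤-trans (convergent-near n<j) (unit-anti-≤ (qqa≤qd n)))
      (a-lower (q n) {{q-nonZero n}})
    where
    qqa≤qd : ∀ n → q n ℕ.* q n ℕ.* suc (a (q n)) ℕ.≤ q n ℕ.* d (suc n)
    qqa≤qd n = subst (ℕ._≤ q n ℕ.* d (suc n)) (identity (q n) (suc (a (q n)))) (ℕ.*-monoʳ-≤ (q n) (q*≤d n))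
      where
      identity : ∀ q m → q ℕ.* (m ℕ.* q) ≡ q ℕ.* q ℕ.* m
      identity = ℕ-Ring.solve-∀

  -- The condition of `Contracting` for A = q q⁺ and B = q²(m + 1), where a = m + 2. Here q⁺ = q +
  -- (m + 3)q + d ≤ (m + 5)q, and k(m + 5) ≤ (k + 1)(m + 1) amounts to 4k ≤ m + 1.
  denominator-bound : ∀ k m {d q} → k ℕ.* 4 ℕ.≤ m → d ℕ.≤ q →
    k ℕ.* (q ℕ.* (q ℕ.+ (suc (suc (suc m)) ℕ.* q ℕ.+ d))) ℕ.≤ suc k ℕ.* (q ℕ.* q ℕ.* suc m)
  denominator-bound k m {d} {q} 4k≤m d≤q = begin
    k ℕ.* (q ℕ.* (q ℕ.+ (suc (suc (suc m)) ℕ.* q ℕ.+ d)))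
      ≤⟨ ℕ.*-monoʳ-≤ k (ℕ.*-monoʳ-≤ q (ℕ.+-monoʳ-≤ q (ℕ.+-monoʳ-≤ (suc (suc (suc m)) ℕ.* q) d≤q))) ⟩
    k ℕ.* (q ℕ.* (q ℕ.+ (suc (suc (suc m)) ℕ.* q ℕ.+ q)))
      ≡⟨ identity₁ k m q ⟩
    (k ℕ.* m ℕ.+ k ℕ.+ k ℕ.* 4) ℕ.* (q ℕ.* q)
      ≤⟨ ℕ.*-monoˡ-≤ (q ℕ.* q) (ℕ.+-monoʳ-≤ (k ℕ.* m ℕ.+ k) (ℕ.≤-trans 4k≤m (ℕ.n≤1+n m))) ⟩
    (k ℕ.* m ℕ.+ k ℕ.+ suc m) ℕ.* (q ℕ.* q)
      ≡⟨ identity₂ k m q ⟩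
    suc k ℕ.* (q ℕ.* q ℕ.* suc m) ∎
    where
    open ℕ.≤-Reasoning
    identity₁ : ∀ k m q → k ℕ.* (q ℕ.* (q ℕ.+ (suc (suc (suc m)) ℕ.* q ℕ.+ q))) ≡ (k ℕ.* m ℕ.+ k ℕ.+ k ℕ.* 4) ℕ.* (q ℕ.* q)
    identity₁ = ℕ-Ring.solve-∀
    identity₂ : ∀ k m q → (k ℕ.* m ℕ.+ k ℕ.+ suc m) ℕ.* (q ℕ.* q) ≡ suc k ℕ.* (q ℕ.* q ℕ.* suc m)
    identity₂ = ℕ-Ring.solve-∀

  qq≢0 : ∀ n → NonZero (q n ℕ.* q (suc n))
  qq≢0 n = ℕ.m*n≢0 (q n) (q (suc n)) {{q-nonZero n}} {{q-nonZero (suc n)}}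

  convergent-separated : ∀ ε → ∃[ N ] (∀ n → N ℕ.≤ q n →
    proj₁ (value (fromℕ≥1 (q n) {{q-nonZero n}}) (μ +⁺ ε)) < fromℚ (unit (q n ℕ.* q (suc n))))
  convergent-separated ε =
    let (k , N₁ , contract) = contracting ε
        -- By `a-large` this index gives a ≥ 4k + 2, so m = a - 2 is a true difference with m ≥ 4k.
        (N₂ , small) = vanishing (suc (k ℕ.* 4))
    in N₁ ℕ.⊔ N₂ , λ n N≤q → separated k n
         (contract (q n) {{q-nonZero n}} (ℕ.m⊔n≤o⇒m≤o N₁ N₂ N≤q))
         (a-large (q n) {{q-nonZero n}} (small (q n) {{q-nonZero n}} (ℕ.m⊔n≤o⇒n≤o N₁ N₂ N≤q)))
    where
    separated : ∀ k n → (∀ A B .{{_ : NonZero A}} .{{_ : NonZero B}} → k ℕ.* A ℕ.≤ suc k ℕ.* B →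
      f⟨q n ⟩ < fromℚ (unit B) → proj₁ (value (fromℕ≥1 (q n) {{q-nonZero n}}) (μ +⁺ ε)) < fromℚ (unit A)) →
      suc (k ℕ.* 4) ℕ.< a (q n) →
      proj₁ (value (fromℕ≥1 (q n) {{q-nonZero n}}) (μ +⁺ ε)) < fromℚ (unit (q n ℕ.* q (suc n)))
    separated k n contract large = contract (q n ℕ.* q (suc n)) (q n ℕ.* q n ℕ.* suc m)
      {{qq≢0 n}} {{ℕ.m*n≢0 (q n ℕ.* q n) (suc m) {{ℕ.m*n≢0 (q n) (q n) {{q-nonZero n}} {{q-nonZero n}}}}}}
      (subst (λ a → k ℕ.* (q n ℕ.* (q n ℕ.+ (suc a ℕ.* q n ℕ.+ d n))) ℕ.≤ suc k ℕ.* (q n ℕ.* q n ℕ.* suc m)) (sym a≡2+m)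
        (denominator-bound k m (ℕ.∸-monoˡ-≤ 2 large) (d≤q n)))
      (a-upper (q n) {{q-nonZero n}} a≡2+m)
      where
      m = a (q n) ℕ.∸ 2
      a≡2+m : a (q n) ≡ suc (suc m)
      a≡2+m = sym (ℕ.m+[n∸m]≡n (ℕ.≤-trans (ℕ.s≤s (ℕ.s≤s ℕ.z≤n)) large))

  admissible : Admissible f limit μ
  admissible ε =
    let (N , separated) = convergent-separated ε
        -- For the finitely many left endpoints of denominator below `N`: each is at least 1/(q q⁺)
        -- from the limit, and its q q⁺ is bounded by this product at index `N`.
        (N₁ , below-W) = vanishing (q N ℕ.* q (suc N))
        -- The index 7 yields the bound 1/(8Q²) for fractions that are not left endpoints.
        (N₂ , below-8) = vanishing 7
    -- The successor makes the threshold a positive integer.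
    in suc (N₁ ℕ.⊔ N₂) , ℕ.nonZero , λ P Q Q≥ →
      let N₁⊔N₂≤Q = ℕ.≤-trans (ℕ.n≤1+n (N₁ ℕ.⊔ N₂)) Q≥
          (n , cases) = convergent-or-far P Q
      in by-cases P Q N n (separated n)
           (below-W Q (ℕ.m⊔n≤o⇒m≤o N₁ N₂ N₁⊔N₂≤Q)) (below-8 Q (ℕ.m⊔n≤o⇒n≤o N₁ N₂ N₁⊔N₂≤Q)) cases
    where
    v : ∀ Q .{{_ : NonZero Q}} → ℝ
    v Q = proj₁ (value (fromℕ≥1 Q) (μ +⁺ ε))

    below : ∀ Q .{{_ : NonZero Q}} {x} → f⟨ Q ⟩ < x → v Q < x
    below Q {x} = <-trans {v Q} {f⟨ Q ⟩} {x} (value-+ f (fromℕ≥1 Q) μ ε)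

    identity : ∀ Q → Q ℕ.* 4 ℕ.* Q ℕ.* 2 ≡ Q ℕ.* Q ℕ.* 8
    identity = ℕ-Ring.solve-∀

    small-denominator : ∀ N n Q .{{_ : NonZero Q}} → q n ℕ.< N →
      q n ℕ.* q (suc n) ℕ.≤ Q ℕ.* Q ℕ.* suc (q N ℕ.* q (suc N))
    small-denominator N n Q q<N = ℕ.≤-trans (ℕ.*-mono-≤ (q-mono n≤N) (q-mono (ℕ.s≤s n≤N)))
      (ℕ.≤-trans (ℕ.n≤1+n _) (ℕ.m≤n*m (suc (q N ℕ.* q (suc N))) (Q ℕ.* Q) {{ℕ.m*n≢0 Q Q}}))
      where n≤N = ℕ.<⇒≤ (ℕ.<-trans (n<q n) q<N)

    -- A convergent with denominator below N is bounded away from the limit, however large the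
    -- denominator Q of the fraction representing it.
    convergent-case : ∀ Q .{{_ : NonZero Q}} N n → q n ℕ.≤ Q →
      (N ℕ.≤ q n → v (q n) {{q-nonZero n}} < fromℚ (unit (q n ℕ.* q (suc n)))) →
      f⟨ Q ⟩ < fromℚ (unit (Q ℕ.* Q ℕ.* suc (q N ℕ.* q (suc N)))) → v Q < fromℚ (unit (q n ℕ.* q (suc n)))
    convergent-case Q N n q≤Q separated below-W = [ large , small ]′ (ℕ.≤-<-connex N (q n))
      where
      y = fromℚ (unit (q n ℕ.* q (suc n)))

      large : N ℕ.≤ q n → v Q < y
      large N≤q = value-anti-≤ f {q n} {Q} {μ +⁺ ε} {y} {{q-nonZero n}} q≤Q (separated N≤q)

      small : q n ℕ.< N → v Q < y
      small q<N = <-≲-trans {v Q} {fromℚ (unit (Q ℕ.* Q ℕ.* suc (q N ℕ.* q (suc N))))} {y}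
        (below Q {fromℚ (unit (Q ℕ.* Q ℕ.* suc (q N ℕ.* q (suc N))))} below-W)
        (0 , λ _ → unit-anti-≤ (small-denominator N n Q q<N))

    by-cases : ∀ P Q .{{_ : NonZero Q}} N n →
      (N ℕ.≤ q n → v (q n) {{q-nonZero n}} < fromℚ (unit (q n ℕ.* q (suc n)))) →
      f⟨ Q ⟩ < fromℚ (unit (Q ℕ.* Q ℕ.* suc (q N ℕ.* q (suc N)))) →
      f⟨ Q ⟩ < fromℚ (unit (Q ℕ.* Q ℕ.* 8)) →
      ConvergentOrFar P Q n → v Q < ∣ limit - fromℚ (P ℚ./ Q) ∣
    by-cases P Q N n separated below-W below-8 (inj₁ (q≤Q , P/Q≡left)) =
      <-≲-trans {v Q} {fromℚ (unit (q n ℕ.* q (suc n)))} {∣ limit - fromℚ (P ℚ./ Q) ∣}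
        (convergent-case Q N n q≤Q separated below-W)
        (suc n , λ {j} n<j → subst (λ r → unit (q n ℕ.* q (suc n)) ℚ.≤ ℚ.∣ left j ℚ.- r ∣) (sym P/Q≡left) (convergent-far n<j))
    by-cases P Q N n separated below-W below-8 (inj₂ far) =
      <-≲-trans {v Q} {fromℚ (unit (Q ℕ.* Q ℕ.* 8))} {∣ limit - fromℚ (P ℚ./ Q) ∣}
        (below Q {fromℚ (unit (Q ℕ.* Q ℕ.* 8))} below-8)
        (suc n , λ {j} n<j → subst (λ m → unit m ℚ.≤ ℚ.∣ left j ℚ.- P ℚ./ Q ∣) (identity Q) (far n<j))

theorem3 : (f : IrrationalityMeasure) (let open IrrationalityMeasure f) (μ : ℝ⁺) →
    LittleO (λ x → proj₁ (value x μ)) (λ x → x ⁻¹ * x ⁻¹) →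
    (∀ (ε : ℝ⁺) → Σ[ c ∈ ℝ⁺ ] proj₁ c < 1ℝ ×
    Eventually (λ x → proj₁ (value x (μ +⁺ ε)) < proj₁ c * proj₁ (value x μ))) →
    Σ[ θ ∈ ℝ ] Irrational θ × HasIrrationalityMeasure f θ μ × ApproximableToOrder θ (at μ)
theorem3 f μ small contraction = limit , admissible⇒irrational f {limit} {μ} admissible ,
  (admissible , approximable⇒minimal f {limit} {μ} approximable) , approximable
  where
  open Construction f μ (littleO⇒vanishing f μ small) (contraction⇒contracting f μ contraction)
  open SternBrocot a
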